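{- Let $p$ be a prime number, let $i,j\in\mathbb{Z}$, and let $C^{(p;i,j)}$ be the hyperelliptic curve over $\mathbb{Q}$ defined by \[y^2=x(x^2+2^ip^{j})(x^2+2^{i+1}p^{j}).\] Suppose that one of the following conditions holds: (1) $p\equiv 3 \pmod{16}$ and $(i,j)=(0,1)$; (2) $p\equiv 11 \pmod{16}$ and $(i,j)=(1,1)$; (3) $p\equiv 3 \pmod{8}$ and $(i,j)=(0,2)$; (4) $p\equiv -3 \pmod{8}$ and $(i,j)=(0,2)$. Then $C^{(p;i,j)}(\mathbb{Q})=\{(0,0),\infty\}$.
   Context: The curve is the genus-2 hyperelliptic curve given by the affine equation above (the right-hand side is a separable polynomial of degree 5), and $\infty$ denotes its unique point at infinity. -}

module Defs where

open import Data.Nat using (ℕ; _%_; _^_)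
import Data.Nat as ℕ
open import Data.Integer using (+_)
open import Data.Rational using (ℚ; _+_; _*_; _/_)
open import Data.Product using (_×_)
open import Data.Sum using (_⊎_)
open import Relation.Binary.PropositionalEquality using (_≡_)

-- the coefficient 2^i p^j as a rational number (i, j ≥ 0 in all cases of the theorem)
coeff : ℕ → ℕ → ℕ → ℚ
coeff p i j = (+ (2 ^ i ℕ.* p ^ j)) / 1

rhs : ℕ → ℕ → ℕ → ℚ → ℚ
rhs p i j x = x * ((x * x + coeff p i j) * (x * x + coeff p (ℕ.suc i) j))

OnCurve : ℕ → ℕ → ℕ → ℚ → ℚ → Set
OnCurve p i j x y = y * y ≡ rhs p i j x

-- the four hypotheses of the theorem (note -3 ≡ 5 mod 8)
Cond : ℕ → ℕ → ℕ → Set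
Cond p i j =
    (p % 16 ≡ 3 × i ≡ 0 × j ≡ 1)
  ⊎ (p % 16 ≡ 11 × i ≡ 1 × j ≡ 1)
  ⊎ (p % 8 ≡ 3 × i ≡ 0 × j ≡ 2)
  ⊎ (p % 8 ≡ 5 × i ≡ 0 × j ≡ 2)

{-# OPTIONS --safe #-}
module Submission where

-- Writing x = m / n in lowest terms, n = s² and m (m² + a s⁴) (m² + 2 a s⁴) is a square.  The three
-- factors are coprime up to 2 and p, so each of them is a square up to 2 and p.  Most distributions
-- of 2 and p are excluded because 2 (resp. -1, -2) is not a square modulo p; the others lead to
-- t⁴ + Q s⁴ = v² with Q = 1, 2, 4, 2p or 2p³, which has no solution with s ≠ 0 by infinite descent.
-- For a = p² there remain pairs such as t⁴ + p² s⁴ = u², t⁴ + 2 p² s⁴ = v²: one descent step on each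
-- equation writes s = 2 e f = 2 g h, and putting e = y x, f = z w, g = z x, h = y w and eliminating t
-- gives y⁴ (x⁴ + 8 p² w⁴) = z⁴ (x⁴ + 4 p² w⁴) or a variant of it, whose factors match by coprimality;
-- then y⁴ - x⁴ is a square, or z⁴ = x⁴ + 8 w⁴, and the descents for Q = 4 and Q = 2 apply.

open import Defs
open import Data.Nat hiding (parity)
open import Data.Nat.Properties
open import Data.Nat.Induction using (<-rec)
open import Data.Nat.Divisibility
open import Data.Nat.DivMod
open import Data.Nat.GCD using (gcd; gcd[m,n]∣m; gcd[m,n]∣n; gcd-greatest; gcd[m,n]≡0⇒m≡0; module Bézout)
open import Data.Nat.Coprimality as Coprime using (Coprime; coprime-divisor; coprime-Bézout)
open import Data.Nat.Primality using (Prime; prime[2]; prime⇒irreducible; prime⇒nonZero; prime⇒nonTrivial; euclidsLemma)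
open import Data.Nat.Tactic.RingSolver using (solve-∀)
import Data.Integer as ℤ
import Data.Integer.Properties as ℤ
import Data.Rational as ℚ
open import Data.Rational using (ℚ; mkℚ; 0ℚ; toℚᵘ; ↥_)
import Data.Rational.Properties as ℚ
import Data.Rational.Unnormalised as ℚᵘ
open import Data.Rational.Unnormalised using (mkℚᵘ; *≡*)
import Data.Rational.Unnormalised.Properties as ℚᵘ
open import Data.Product using (_×_; _,_; ∃; ∃₂; proj₁; proj₂)
open import Data.Sum using (_⊎_; inj₁; inj₂; [_,_]′; reduce)
open import Data.Empty using (⊥; ⊥-elim)
open import Function.Base using (it)
open import Function.Bundles using (_⇔_; mk⇔)
open import Relation.Nullary using (¬_; Dec; yes; no; contradiction)
open import Relation.Nullary.Decidable using (from-yes; _→-dec_; _⊎-dec_; _×-dec_)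
open import Relation.Binary.PropositionalEquality

-- For Q = m q the two steps of the descent are the 2-isogeny from Y² = X³ + Q X to Y² = X³ - 4 Q X
-- and its dual: t⁴ + Q s⁴ = v² leads to a⁴ = t² + 4 Q b⁴, and this leads back to a² = d⁴ + Q c⁴.
-- Here m is 1, 2 or 4 and q is 1, p or p³. A prime power cannot be shared between two coprime
-- factors, so every step has four cases; residues modulo 8 remove the unwanted ones. For a = p² one
-- equation of the pair is not enough: 7⁴ + 9 · 20⁴ = 1201² solves t⁴ + p² s⁴ = u² for p = 3. This
-- is why the two equations have to be combined by elimination. Signs never matter: absolute values
-- are taken when denominators are cleared, and the rest takes place in ℕ.

private variable
  a b c d i j k m n p q r s t u v w x y z : ℕ

infix 9 _² _⁴

_² _⁴ : ℕ → ℕ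
n ² = n * n
n ⁴ = n ² * n ²

-- Coprimality

coprime-∣ : a ∣ c → b ∣ d → Coprime c d → Coprime a b
coprime-∣ a∣c b∣d cop (e∣a , e∣b) = cop (∣-trans e∣a a∣c , ∣-trans e∣b b∣d)

coprime-* : Coprime a b → Coprime a c → Coprime a (b * c)
coprime-* ab ac (d∣a , d∣bc) = ac (d∣a , coprime-divisor (coprime-∣ d∣a ∣-refl ab) d∣bc)

coprime-*ˡ : Coprime a c → Coprime b c → Coprime (a * b) c
coprime-*ˡ ac bc = Coprime.sym (coprime-* (Coprime.sym ac) (Coprime.sym bc))

coprime-² : Coprime a b → Coprime a (b ²)
coprime-² ab = coprime-* ab ab

coprime-⁴ : Coprime a b → Coprime a (b ⁴)
coprime-⁴ ab = coprime-² (coprime-² ab)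

coprime-^ : ∀ k → Coprime a b → Coprime (a ^ k) b
coprime-^ zero    ab = Coprime.1-coprimeTo _
coprime-^ (suc k) ab = coprime-*ˡ ab (coprime-^ k ab)

∤⇒coprime : Prime p → p ∤ n → Coprime p n
∤⇒coprime pr p∤n (d∣p , d∣n) with prime⇒irreducible pr d∣p
... | inj₁ d≡1  = d≡1
... | inj₂ refl = contradiction d∣n p∤n

coprime⇒∤ : Prime p → p ∣ m → Coprime m n → p ∤ n
coprime⇒∤ pr p∣m mn p∣n =
  nonTrivial⇒≢1 {{prime⇒nonTrivial pr}} (mn (p∣m , p∣n))

prime∣²⇒∣ : Prime p → p ∣ n ² → p ∣ n
prime∣²⇒∣ {n = n} pr p∣n² = reduce (euclidsLemma n n pr p∣n²)

prime∣⁴⇒∣ : Prime p → p ∣ n ⁴ → p ∣ n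
prime∣⁴⇒∣ {n = n} pr p∣n⁴ = prime∣²⇒∣ {n = n} pr (prime∣²⇒∣ {n = n ²} pr p∣n⁴)

lowest-terms : ∀ x z .{{_ : NonZero x}} →
  ∃ λ g → ∃₂ λ x′ z′ → NonZero g × x ≡ x′ * g × z ≡ z′ * g × Coprime x′ z′
lowest-terms x z = g , quotient g∣x , quotient g∣z , g≢0 , _∣_.equality g∣x , _∣_.equality g∣z , cop
  where
  g = gcd x z
  g∣x = gcd[m,n]∣m x z
  g∣z = gcd[m,n]∣n x z
  g≢0 : NonZero g
  g≢0 = ≢-nonZero λ g≡0 → ≢-nonZero⁻¹ x (gcd[m,n]≡0⇒m≡0 g≡0)
  cop : Coprime (quotient g∣x) (quotient g∣z)
  cop {d} (d∣x′ , d∣z′) = ∣1⇒≡1 (*-cancelʳ-∣ g {{g≢0}} (subst (d * g ∣_) (sym (*-identityˡ g))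
    (gcd-greatest (subst (d * g ∣_) (sym (_∣_.equality g∣x)) (*-monoˡ-∣ g d∣x′))
                  (subst (d * g ∣_) (sym (_∣_.equality g∣z)) (*-monoˡ-∣ g d∣z′)))))

-- Coprime factors of powers

-- No prime factorisation is needed: cancelling g = gcd x z leaves x′ y = g z′². Since x′ is coprime
-- to z′ and g to y, x′ and g divide each other, so x = g² and y = z′².
square-split : Coprime x y → x * y ≡ z ² → ∃₂ λ a b → x ≡ a ² × y ≡ b ² × z ≡ a * b
square-split {zero} {y} {z} cop eq = 0 , 1 , refl , Coprime.0-coprimeTo-m⇒m≡1 cop
  , reduce (m*n≡0⇒m≡0∨n≡0 z (sym eq))
square-split {x@(suc _)} {y} {z} cop eq with lowest-terms x z
... | g , x′ , z′ , g≢0 , x≡ , z≡ , cop′ =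
  g , z′ , trans x≡ (cong (_* g) x′≡g) , y≡ , trans z≡ (*-comm z′ g)
  where
  instance _ = g≢0
  x′y≡ : x′ * y ≡ g * z′ ²
  x′y≡ = *-cancelˡ-≡ _ _ g (begin
    g * (x′ * y)         ≡⟨ ident₁ g x′ y ⟩
    x′ * g * y           ≡⟨ cong (_* y) (sym x≡) ⟩
    x * y                ≡⟨ eq ⟩
    z ²                  ≡⟨ cong _² z≡ ⟩
    (z′ * g) ²           ≡⟨ ident₂ g z′ ⟩
    g * (g * z′ ²)       ∎)
    where
    open ≡-Reasoning
    ident₁ : ∀ g x y → g * (x * y) ≡ x * g * y
    ident₁ = solve-∀
    ident₂ : ∀ g z → z * g * (z * g) ≡ g * (g * (z * z))
    ident₂ = solve-∀
  x′∣g : x′ ∣ g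
  x′∣g = coprime-divisor (coprime-² cop′)
    (subst (x′ ∣_) (trans x′y≡ (*-comm g (z′ ²))) (m∣m*n y))
  g∣x′ : g ∣ x′
  g∣x′ = coprime-divisor (coprime-∣ (divides x′ x≡) ∣-refl cop)
    (subst (g ∣_) (trans (sym x′y≡) (*-comm x′ y)) (m∣m*n (z′ ²)))
  x′≡g = ∣-antisym x′∣g g∣x′
  y≡ : y ≡ z′ ²
  y≡ = *-cancelˡ-≡ _ _ g (trans (cong (_* y) (sym x′≡g)) x′y≡)

fourth-split : Coprime x y → x * y ≡ z ⁴ → ∃₂ λ a b → x ≡ a ⁴ × y ≡ b ⁴ × z ≡ a * b
fourth-split {z = z} cop eq with square-split {z = z ²} cop eq
... | g , h , refl , refl , z²≡
  with square-split {x = g} {y = h} {z = z} (coprime-∣ (m∣m*n g) (m∣m*n h) cop) (sym z²≡)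
... | a , b , refl , refl , z≡ = a , b , refl , refl , z≡

-- After division by gcd x z, the number x′ divides z′² and is coprime to it, hence x′ = 1.
square-cancel : .{{_ : NonZero x}} → x ² * w ≡ z ² → ∃ λ z′ → z ≡ x * z′ × w ≡ z′ ²
square-cancel {x} {w} {z} eq with lowest-terms x z
... | g , x′ , z′ , g≢0 , x≡ , z≡ , cop =
  z′ , trans z≡ (trans (*-comm z′ g) (cong (_* z′) (sym x≡g))) , w≡
  where
  instance _ = g≢0
  instance _ = m*n≢0 g g
  eq′ : x′ ² * w ≡ z′ ²
  eq′ = *-cancelˡ-≡ _ _ (g ²) (begin
    g ² * (x′ ² * w)    ≡⟨ ident₁ g x′ w ⟩
    (x′ * g) ² * w      ≡⟨ cong (λ k → k ² * w) (sym x≡) ⟩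
    x ² * w             ≡⟨ eq ⟩
    z ²                 ≡⟨ cong _² z≡ ⟩
    (z′ * g) ²          ≡⟨ ident₂ g z′ ⟩
    g ² * z′ ²          ∎)
    where
    open ≡-Reasoning
    ident₁ : ∀ g x w → g * g * (x * x * w) ≡ x * g * (x * g) * w
    ident₁ = solve-∀
    ident₂ : ∀ g z → z * g * (z * g) ≡ g * g * (z * z)
    ident₂ = solve-∀
  x′≡1 : x′ ≡ 1
  x′≡1 = coprime-² cop (∣-refl , subst (x′ ∣_) eq′ (∣m⇒∣m*n w (m∣m*n x′)))
  x≡g : x ≡ g
  x≡g = trans x≡ (trans (cong (_* g) x′≡1) (*-identityˡ g))
  w≡ : w ≡ z′ ²
  w≡ = trans (sym (trans (cong (λ k → k ² * w) x′≡1) (*-identityˡ w))) eq′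

-- The one property of prime powers (and of 1) that the splittings use; it lets 1, powers of 2, p,
-- p² and p³ be treated alike.
Primary : ℕ → Set
Primary q = ∀ {x y} → Coprime x y → q ∣ x * y → q ∣ x ⊎ q ∣ y

primary-1 : Primary 1
primary-1 {x} _ _ = inj₁ (1∣ x)

primary-^ : Prime p → ∀ k → Primary (p ^ k)
primary-^ {p} pr k {x} {y} cop h with p ∣? x
... | yes p∣x = inj₁ (coprime-divisor (coprime-^ k (∤⇒coprime pr (coprime⇒∤ pr p∣x cop)))
                        (subst (p ^ k ∣_) (*-comm x y) h))
... | no  p∤x = inj₂ (coprime-divisor (coprime-^ k (∤⇒coprime pr p∤x)) h)

primary-split : .{{_ : NonZero q}} → Primary q → Coprime x y → x * y ≡ q * w →
  (∃ λ x′ → x ≡ q * x′ × x′ * y ≡ w × Coprime x′ y) ⊎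
  (∃ λ y′ → y ≡ q * y′ × x * y′ ≡ w × Coprime x y′)
primary-split {q} {x} {y} {w} prim cop eq with prim cop (subst (q ∣_) (sym eq) (m∣m*n w))
... | inj₁ (divides-refl k) = inj₁ (k , *-comm k q ,
  *-cancelˡ-≡ _ _ q (trans (ident q k y) eq) , coprime-∣ (m∣m*n q) ∣-refl cop)
  where
  ident : ∀ q k y → q * (k * y) ≡ k * q * y
  ident = solve-∀
... | inj₂ (divides-refl k) = inj₂ (k , *-comm k q ,
  *-cancelˡ-≡ _ _ q (trans (ident q x k) eq) , coprime-∣ ∣-refl (m∣m*n q) cop)
  where
  ident : ∀ q x k → q * (x * k) ≡ x * (k * q)
  ident = solve-∀

-- Each constructor name displays the two factors, `x` before the dot and `y` after it. The root `b`
-- always accompanies `m`, so exchanging `x` and `y` permutes the constructors without renaming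
-- roots.
data Split (m q z x y : ℕ) : Set where
  mqb⁴·a⁴ : ∀ a b → x ≡ m * (q * b ⁴) → y ≡ a ⁴ → z ≡ a * b → Split m q z x y
  mb⁴·qa⁴ : ∀ a b → x ≡ m * b ⁴ → y ≡ q * a ⁴ → z ≡ a * b → Split m q z x y
  qa⁴·mb⁴ : ∀ a b → x ≡ q * a ⁴ → y ≡ m * b ⁴ → z ≡ a * b → Split m q z x y
  a⁴·mqb⁴ : ∀ a b → x ≡ a ⁴ → y ≡ m * (q * b ⁴) → z ≡ a * b → Split m q z x y

split : .{{_ : NonZero m}} .{{_ : NonZero q}} → Primary m → Primary q →
  Coprime x y → x * y ≡ m * (q * z ⁴) → Split m q z x y
split {z = z} pm pq cop eq with primary-split pm cop eq
... | inj₁ (x₁ , refl , eq₁ , cop₁) with primary-split pq cop₁ eq₁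
...   | inj₁ (x₂ , refl , eq₂ , cop₂) with fourth-split {z = z} cop₂ eq₂
...     | b , a , refl , refl , refl = mqb⁴·a⁴ a b refl refl (*-comm b a)
split {z = z} pm pq cop eq | inj₁ (x₁ , refl , eq₁ , cop₁) | inj₂ (y₂ , refl , eq₂ , cop₂)
  with fourth-split {z = z} cop₂ eq₂
...     | b , a , refl , refl , refl = mb⁴·qa⁴ a b refl refl (*-comm b a)
split {z = z} pm pq cop eq | inj₂ (y₁ , refl , eq₁ , cop₁) with primary-split pq cop₁ eq₁
...   | inj₁ (x₂ , refl , eq₂ , cop₂) with fourth-split {z = z} cop₂ eq₂
...     | a , b , refl , refl , refl = qa⁴·mb⁴ a b refl refl refl
split {z = z} pm pq cop eq | inj₂ (y₁ , refl , eq₁ , cop₁) | inj₂ (y₂ , refl , eq₂ , cop₂)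
  with fourth-split {z = z} cop₂ eq₂
...     | a , b , refl , refl , refl = a⁴·mqb⁴ a b refl refl refl

-- Residues modulo 8

mod-+ : ∀ n .{{_ : NonZero n}} a b → a % n ≡ r → b % n ≡ s → (a + b) % n ≡ (r + s) % n
mod-+ n a b refl refl = %-distribˡ-+ a b n

mod-* : ∀ n .{{_ : NonZero n}} a b → a % n ≡ r → b % n ≡ s → (a * b) % n ≡ (r * s) % n
mod-* n a b refl refl = %-distribˡ-* a b n

Odd Even : ℕ → Set
Odd  n = n % 2 ≡ 1
Even n = n % 2 ≡ 0

even-or-odd : ∀ n → Even n ⊎ Odd n
even-or-odd n with n % 2 | m%n<n n 2
... | 0 | _ = inj₁ refl
... | 1 | _ = inj₂ refl
... | suc (suc _) | s≤s (s≤s ())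

even-half : Even n → ∃ λ k → n ≡ 2 * k
even-half {n} even with divides k eq ← m%n≡0⇒n∣m n 2 even = k , trans eq (*-comm k 2)

¬even∧odd : Even n → Odd n → ⊥
¬even∧odd even odd with () ← trans (sym even) odd

odd-*ˡ : ∀ a → Odd (a * b) → Odd a
odd-*ˡ {b} a odd with even-or-odd a
... | inj₁ even = ⊥-elim (¬even∧odd {a * b} (mod-* 2 a b even refl) odd)
... | inj₂ odd-a = odd-a

odd-*ʳ : ∀ a → Odd (a * b) → Odd b
odd-*ʳ {b} a odd = odd-*ˡ b (trans (cong (_% 2) (*-comm b a)) odd)

odd-⁴ : ∀ a → Odd (a ⁴) → Odd a
odd-⁴ a odd = odd-*ˡ a (odd-*ˡ (a ²) odd)

odd² : ∀ n → Odd n → n ² % 8 ≡ 1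
odd² n odd = trans (%-distribˡ-* n n 8)
  (table (m%n<n n 8) (trans (m∣n⇒o%n%m≡o%m 2 8 n (divides 4 refl)) odd))
  where
  table : ∀ {r} → r < 8 → r % 2 ≡ 1 → r * r % 8 ≡ 1
  table = from-yes (allUpTo? (λ r → (r % 2 ≟ 1) →-dec (r * r % 8 ≟ 1)) 8)

odd⁴ : ∀ n → Odd n → n ⁴ % 8 ≡ 1
odd⁴ n odd = mod-* 8 (n ²) (n ²) (odd² n odd) (odd² n odd)

²-mod-8 : ∀ n → n ² % 8 ≡ 0 ⊎ n ² % 8 ≡ 1 ⊎ n ² % 8 ≡ 4
²-mod-8 n = subst (λ k → k ≡ 0 ⊎ k ≡ 1 ⊎ k ≡ 4) (sym (%-distribˡ-* n n 8)) (table (m%n<n n 8))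
  where
  table : ∀ {r} → r < 8 → r * r % 8 ≡ 0 ⊎ r * r % 8 ≡ 1 ⊎ r * r % 8 ≡ 4
  table = from-yes (allUpTo? (λ r → (r * r % 8 ≟ 0) ⊎-dec ((r * r % 8 ≟ 1) ⊎-dec (r * r % 8 ≟ 4))) 8)

mod-8⇒odd : ∀ n → n % 8 ≡ r → Odd r → Odd n
mod-8⇒odd n refl odd = trans (sym (m∣n⇒o%n%m≡o%m 2 8 n (divides 4 refl))) odd

odd⇒coprime-2 : Odd n → Coprime n 2
odd⇒coprime-2 {n} odd = Coprime.sym (∤⇒coprime prime[2]
  λ 2∣n → ¬even∧odd {n} (n∣m⇒m%n≡0 n 2 2∣n) odd)

even∧coprime⇒odd : Even m → Coprime m n → Odd n
even∧coprime⇒odd {m} {n} even cop with even-or-odd n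
... | inj₂ odd = odd
... | inj₁ even′ with () ← cop (m%n≡0⇒n∣m m 2 even , m%n≡0⇒n∣m n 2 even′)

-- Here x = (a - b) / 2 and x + b = (a + b) / 2. The division is exact because a - b and a + b have
-- the same parity and their product is a multiple of 4.
difference-of-squares : ∀ a b k → a ² ≡ b ² + 4 * k → ∃ λ x → a ≡ b + 2 * x × x * (x + b) ≡ k
difference-of-squares a b k eq = conclude (even-half even)
  where
  b≤a : b ≤ a
  b≤a = ≮⇒≥ λ a<b → <⇒≱ (*-mono-< a<b a<b) (subst (b ² ≤_) (sym eq) (m≤m+n _ _))
  δ = a ∸ b
  a≡ : a ≡ b + δ
  a≡ = sym (m+[n∸m]≡n b≤a)
  eq′ : δ * (δ + 2 * b) ≡ 4 * k
  eq′ = +-cancelˡ-≡ (b ²) _ _ (trans (ident b δ) (trans (cong _² (sym a≡)) eq))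
    where
    ident : ∀ b d → b * b + d * (d + 2 * b) ≡ (b + d) * (b + d)
    ident = solve-∀
  even : Even δ
  even with even-or-odd δ
  ... | inj₁ even = even
  ... | inj₂ odd with () ← trans (sym (mod-* 2 δ (δ + 2 * b) odd
                         (mod-+ 2 δ (2 * b) odd (mod-* 2 2 b refl refl))))
                         (trans (cong (_% 2) eq′) (mod-* 2 4 k refl refl))
  conclude : (∃ λ x → δ ≡ 2 * x) → _
  conclude (x , δ≡) = x , trans a≡ (cong (b +_) δ≡) ,
    *-cancelˡ-≡ _ _ 4 (trans (ident x b) (trans (cong (λ d → d * (d + 2 * b)) (sym δ≡)) eq′))
    where
    ident : ∀ x b → 4 * (x * (x + b)) ≡ 2 * x * (2 * x + 2 * b)
    ident = solve-∀

-- The quartics t⁴ + Q s⁴ = v²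

-- Residues for which m cannot divide q a⁴ + t² with t odd: for a even the sum is odd, and for a odd
-- it is 2 modulo 4 in the first case and 4 modulo 8 in the second.
Separated : ℕ → ℕ → Set
Separated m q = (m % 4 ≡ 0 × q % 4 ≡ 1) ⊎ (m % 8 ≡ 0 × q % 8 ≡ 3)

no-sum : Separated m q → Odd t → q * a ⁴ + t ² ≡ m * k → ⊥
no-sum {m} {q} {t} {a} {k} sep odd-t eq = impossible sep
  where
  t²%2 : t ² % 2 ≡ 1
  t²%2 = mod-* 2 t t odd-t odd-t
  m%2 : m % 2 ≡ 0
  m%2 = [ (λ h → trans (sym (m∣n⇒o%n%m≡o%m 2 4 m (divides 2 refl))) (cong (_% 2) (proj₁ h)))
        , (λ h → trans (sym (m∣n⇒o%n%m≡o%m 2 8 m (divides 4 refl))) (cong (_% 2) (proj₁ h))) ]′ sep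
  qa⁴%2 : Even a → q * a ⁴ % 2 ≡ 0
  qa⁴%2 even = trans (cong (_% 2) (*-comm q (a ⁴)))
    (mod-* 2 (a ⁴) q (mod-* 2 (a ²) (a ²) (mod-* 2 a a even even) (mod-* 2 a a even even)) refl)
  odd-a : Odd a
  odd-a with even-or-odd a
  ... | inj₂ odd = odd
  ... | inj₁ even with () ← trans (sym (mod-+ 2 (q * a ⁴) (t ²) (qa⁴%2 even) t²%2))
                                  (trans (cong (_% 2) eq) (mod-* 2 m k m%2 refl))
  mod-4 : ∀ n → n % 8 ≡ 1 → n % 4 ≡ 1
  mod-4 n h = trans (sym (m∣n⇒o%n%m≡o%m 4 8 n (divides 2 refl))) (cong (_% 4) h)
  impossible : Separated m q → ⊥
  impossible (inj₁ (m%4 , q%4)) with () ←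
    trans (sym (mod-+ 4 (q * a ⁴) (t ²) (mod-* 4 q (a ⁴) q%4 (mod-4 (a ⁴) (odd⁴ a odd-a)))
                 (mod-4 (t ²) (odd² t odd-t))))
          (trans (cong (_% 4) eq) (mod-* 4 m k m%4 refl))
  impossible (inj₂ (m%8 , q%8)) with () ←
    trans (sym (mod-+ 8 (q * a ⁴) (t ²) (mod-* 8 q (a ⁴) q%8 (odd⁴ a odd-a)) (odd² t odd-t)))
          (trans (cong (_% 8) eq) (mod-* 8 m k m%8 refl))

-- The coprime factors (v - t²) / 2 and (v + t²) / 2 differ by t². If m belonged to the larger one,
-- m would divide the sum of the smaller one and an odd square, against `Separated`; this halves the
-- four cases.
difference-split : .{{_ : NonZero m}} .{{_ : NonZero q}} → Primary m → Primary q → Separated m q →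
  Odd t → Coprime (t ²) (m * (q * z ⁴)) → v ² ≡ t ⁴ + 4 * (m * (q * z ⁴)) →
  ∃₂ λ a b → z ≡ a * b × (a ⁴ ≡ t ² + m * (q * b ⁴) ⊎ q * a ⁴ ≡ t ² + m * b ⁴)
difference-split {m} {q} {t} {z} {v} pm pq sep odd-t cop eq
  with difference-of-squares v (t ²) (m * (q * z ⁴)) eq
... | x , _ , xy≡ = conclude (split pm pq cop′ xy≡)
  where
  cop′ : Coprime x (x + t ²)
  cop′ {d} (d∣x , d∣x+t²) = cop (∣m+n∣m⇒∣n d∣x+t² d∣x , subst (d ∣_) xy≡ (∣m⇒∣m*n _ d∣x))
  m%4 : Separated m q → m % 4 ≡ 0
  m%4 (inj₁ h) = proj₁ h
  m%4 (inj₂ h) = trans (sym (m∣n⇒o%n%m≡o%m 4 8 m (divides 2 refl))) (cong (_% 4) (proj₁ h))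
  conclude : Split m q z x (x + t ²) → _
  conclude (mqb⁴·a⁴ a b refl y≡ z≡) =
    a , b , z≡ , inj₁ (trans (sym y≡) (+-comm _ (t ²)))
  conclude (mb⁴·qa⁴ a b refl y≡ z≡) =
    a , b , z≡ , inj₂ (trans (sym y≡) (+-comm _ (t ²)))
  conclude (qa⁴·mb⁴ a b refl y≡ z≡) = ⊥-elim (no-sum {m = m} {q} {t} {a} sep odd-t y≡)
  conclude (a⁴·mqb⁴ a b refl y≡ z≡) = ⊥-elim (no-sum {m = m} {1} {t} {a} (inj₁ (m%4 sep , refl)) odd-t
    (trans (cong (_+ t ²) (*-identityˡ (a ⁴))) y≡))

-- The values Q = m q for which the descent returns to the same Q. `twice` is meant for q = p and q
-- = p³, both 3 modulo 8 when p is.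
data Admissible : ℕ → ℕ → Set where
  one   : Admissible 1 1
  two   : Admissible 2 1
  four  : Admissible 4 1
  twice : .{{_ : NonZero q}} → Primary q → q % 8 ≡ 3 → Admissible 2 q

admissible-nonZero : Admissible m q → NonZero m × NonZero q
admissible-nonZero one   = _
admissible-nonZero two   = _
admissible-nonZero four  = _
admissible-nonZero (twice {{q≢0}} _ _) = _ , recompute-nonZero q≢0
  where
  recompute-nonZero : .(NonZero n) → NonZero n
  recompute-nonZero {suc n} _ = _

-- The number 4 m enters because s = 2 k turns m q s⁴ into 4 (4 m) q k⁴ in the first step of the
-- descent.
admissible-primary : Admissible m q → Primary m × Primary (4 * m) × Primary q
admissible-primary one         = primary-1 , primary-^ prime[2] 2 , primary-1
admissible-primary two         = primary-^ prime[2] 1 , primary-^ prime[2] 3 , primary-1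
admissible-primary four        = primary-^ prime[2] 2 , primary-^ prime[2] 4 , primary-1
admissible-primary (twice h _) = primary-^ prime[2] 1 , primary-^ prime[2] 3 , h

admissible-separated : Admissible m q → Separated (4 * m) q
admissible-separated one           = inj₁ (refl , refl)
admissible-separated two           = inj₁ (refl , refl)
admissible-separated four          = inj₁ (refl , refl)
admissible-separated (twice _ q≡3) = inj₂ (refl , q≡3)

coprime-⁴-factor : ∀ m q → Coprime t (m * (q * b)) → Coprime t (m * (q * b ⁴))
coprime-⁴-factor {t} {b} m q cop =
  coprime-* {b = m} (coprime-∣ ∣-refl (m∣m*n (q * b)) cop)
    (coprime-* {b = q} (coprime-∣ ∣-refl (∣n⇒∣m*n m (m∣m*n b)) cop)
               (coprime-⁴ (coprime-∣ ∣-refl (∣n⇒∣m*n m (n∣m*n q)) cop)))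

-- The next solution of the quartic: d and c take the places of t and s, and a that of v.
Smaller : (m q a b : ℕ) → Set
Smaller m q a b = ∃₂ λ c d →
  Odd d × Coprime d (m * (q * c)) × a ² ≡ d ⁴ + m * (q * c ⁴) × b ≡ d * c

odd-summandʳ : ∀ m n → Even m → Odd (m + n) → Odd n
odd-summandʳ m n even odd with even-or-odd n
... | inj₂ odd-n = odd-n
... | inj₁ even-n = ⊥-elim (¬even∧odd {m + n} (mod-+ 2 m n even even-n) odd)

even-* : ∀ m n → Even m → Even (m * n)
even-* m n even = mod-* 2 m n even refl

²-odd : ∀ a → Odd a → Odd (a ²)
²-odd a odd = mod-* 2 a a odd odd

coprime-roots : ∀ m q c d → Coprime (m * (q * c ⁴)) (d ⁴) → Coprime d (m * (q * c))
coprime-roots m q c d cop = Coprime.sym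
  (coprime-∣ (divides (c * c ²) (ident m q c)) (∣m⇒∣m*n (d ²) (m∣m*n d)) cop)
  where
  ident : ∀ m q c → m * (q * (c * c * (c * c))) ≡ c * (c * c) * (m * (q * c))
  ident = solve-∀

-- When m and q lie in the same factor, the sum is already the quartic, and only the parity of d is
-- open. For even m it follows from a being odd; for Q = 1 the equation is symmetric, so c and d may
-- be exchanged.
smaller-joint : Admissible m q → ∀ a c d → Coprime (m * (q * c ⁴)) (d ⁴) →
  m * (q * c ⁴) + d ⁴ ≡ a ² → Odd a → b ≡ d * c → Smaller m q a b
smaller-joint {m} {q} {b} adm a c d cop sum odd-a b≡ = go adm
  where
  sum-odd : Odd (m * (q * c ⁴) + d ⁴)
  sum-odd = trans (cong (_% 2) sum) (²-odd a odd-a)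
  with-odd : Odd d → Smaller m q a b
  with-odd odd-d = c , d , odd-d , coprime-roots m q c d cop , trans (sym sum) (+-comm _ (d ⁴)) , b≡
  even-m : Even m → Smaller m q a b
  even-m even = with-odd (odd-⁴ d (odd-summandʳ (m * (q * c ⁴)) _ (even-* m (q * c ⁴) even) sum-odd))
  go : Admissible m q → Smaller m q a b
  go two         = even-m refl
  go four        = even-m refl
  go (twice _ _) = even-m refl
  go one with even-or-odd d
  ... | inj₂ odd-d = with-odd odd-d
  ... | inj₁ even-d = d , c , odd-c , coprime-roots 1 1 d c (Coprime.sym cop₁) , sum₁ , trans b≡ (*-comm d c)
    where
    drop-1 : ∀ n → 1 * (1 * n) ≡ n
    drop-1 n = trans (*-identityˡ (1 * n)) (*-identityˡ n)
    odd-c : Odd c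
    odd-c = odd-⁴ c (subst Odd (drop-1 (c ⁴)) (odd-summandʳ (d ⁴) (1 * (1 * c ⁴))
      (even-* (d ²) (d ²) (even-* d d even-d))
      (trans (cong (_% 2) (+-comm (d ⁴) _)) sum-odd)))
    cop₁ : Coprime (c ⁴) (1 * (1 * d ⁴))
    cop₁ = subst₂ Coprime (drop-1 (c ⁴)) (sym (drop-1 (d ⁴))) cop
    sum₁ : a ² ≡ c ⁴ + 1 * (1 * d ⁴)
    sum₁ = trans (sym sum) (cong₂ _+_ (drop-1 (c ⁴)) (sym (drop-1 (d ⁴))))

-- For q = 1 this is the joint case. For m = 2 and q ≡ 3 modulo 8 the odd number d leaves 2 c⁴ + 3,
-- which is 3 or 5 modulo 8 and never the 1 of an odd square.
smaller-apart : Admissible m q → ∀ a c d → Coprime (m * c ⁴) (q * d ⁴) →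
  m * c ⁴ + q * d ⁴ ≡ a ² → Odd a → b ≡ d * c → Smaller m q a b
smaller-apart {m} {q} {b} adm a c d cop sum odd-a b≡ = go adm
  where
  unit : q ≡ 1 → Smaller m q a b
  unit refl = smaller-joint adm a c d
    (subst₂ Coprime (cong (m *_) (sym (*-identityˡ (c ⁴)))) (*-identityˡ (d ⁴)) cop)
    (trans (cong₂ (λ i j → m * i + j) (*-identityˡ (c ⁴)) (sym (*-identityˡ (d ⁴)))) sum) odd-a b≡
  go : Admissible m q → Smaller m q a b
  go one  = unit refl
  go two  = unit refl
  go four = unit refl
  go (twice _ q≡3) = ⊥-elim (impossible (²-mod-8 (c ²)))
    where
    odd-d : Odd d
    odd-d = odd-⁴ d (odd-*ʳ q (odd-summandʳ (2 * c ⁴) _ (even-* 2 (c ⁴) refl)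
              (trans (cong (_% 2) sum) (²-odd a odd-a))))
    residue : c ⁴ % 8 ≡ r → 1 ≡ (2 * r % 8 + 3) % 8
    residue {r} h = trans (sym (odd² a odd-a)) (trans (cong (_% 8) (sym sum))
      (mod-+ 8 (2 * c ⁴) (q * d ⁴) (mod-* 8 2 (c ⁴) refl h) (mod-* 8 q (d ⁴) q≡3 (odd⁴ d odd-d))))
    impossible : c ⁴ % 8 ≡ 0 ⊎ c ⁴ % 8 ≡ 1 ⊎ c ⁴ % 8 ≡ 4 → ⊥
    impossible (inj₁ h) = contradiction (residue h) λ ()
    impossible (inj₂ (inj₁ h)) = contradiction (residue h) λ ()
    impossible (inj₂ (inj₂ h)) = contradiction (residue h) λ ()

-- The factors (a² - t) / 2 and (a² + t) / 2 are coprime with product m q b⁴. In contrast to the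
-- first step it is their sum a² that counts: it expresses a square by two fourth powers, which is
-- the quartic again.
second-descent : Admissible m q → Odd t → Coprime t (m * (q * b)) →
  a ⁴ ≡ t ² + 4 * (m * (q * b ⁴)) → Smaller m q a b
second-descent {m} {q} {t} {b} {a} adm odd-t cop eq
  with difference-of-squares (a ²) t (m * (q * b ⁴)) eq
... | x , a²≡ , xy≡ = conclude (split pm pq cop′ xy≡)
  where
  instance _ = proj₁ (admissible-nonZero adm)
  instance _ = proj₂ (admissible-nonZero adm)
  pm = proj₁ (admissible-primary adm)
  pq = proj₂ (proj₂ (admissible-primary adm))
  cop′ : Coprime x (x + t)
  cop′ {d} (d∣x , d∣x+t) = coprime-⁴-factor m q cop
    (∣m+n∣m⇒∣n d∣x+t d∣x , subst (d ∣_) xy≡ (∣m⇒∣m*n _ d∣x))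
  sum : x + (x + t) ≡ a ²
  sum = trans (ident x t) (sym a²≡)
    where
    ident : ∀ x t → x + (x + t) ≡ t + 2 * x
    ident = solve-∀
  odd-a : Odd a
  odd-a = odd-⁴ a (trans (cong (_% 2) eq)
    (mod-+ 2 (t ²) (4 * (m * (q * b ⁴))) (²-odd t odd-t) (even-* 4 (m * (q * b ⁴)) refl)))
  conclude : Split m q b x (x + t) → Smaller m q a b
  conclude (mqb⁴·a⁴ d c x≡ y≡ b≡) =
    smaller-joint adm a c d (subst₂ Coprime x≡ y≡ cop′) (trans (cong₂ _+_ (sym x≡) (sym y≡)) sum) odd-a b≡
  conclude (mb⁴·qa⁴ d c x≡ y≡ b≡) =
    smaller-apart adm a c d (subst₂ Coprime x≡ y≡ cop′) (trans (cong₂ _+_ (sym x≡) (sym y≡)) sum) odd-a b≡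
  conclude (qa⁴·mb⁴ d c x≡ y≡ b≡) =
    smaller-apart adm a c d (Coprime.sym (subst₂ Coprime x≡ y≡ cop′))
      (trans (+-comm _ (q * d ⁴)) (trans (cong₂ _+_ (sym x≡) (sym y≡)) sum)) odd-a b≡
  conclude (a⁴·mqb⁴ d c x≡ y≡ b≡) =
    smaller-joint adm a c d (Coprime.sym (subst₂ Coprime x≡ y≡ cop′))
      (trans (+-comm _ (d ⁴)) (trans (cong₂ _+_ (sym x≡) (sym y≡)) sum)) odd-a b≡

-- For odd s the left side is 1 + Q modulo 8, that is 2, 3, 5 or 7, and none of these is a square.
even-root : Admissible m q → Odd t → t ⁴ + m * (q * s ⁴) ≡ v ² → Even s
even-root {m} {q} {t} {s} {v} adm odd-t eq with even-or-odd s
... | inj₁ even = even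
... | inj₂ odd-s = ⊥-elim (go adm)
  where
  v²%8 : m * (q * s ⁴) % 8 ≡ r → v ² % 8 ≡ (1 + r) % 8
  v²%8 h = trans (cong (_% 8) (sym eq)) (mod-+ 8 (t ⁴) (m * (q * s ⁴)) (odd⁴ t odd-t) h)
  mqs⁴%8 : q % 8 ≡ r → m * (q * s ⁴) % 8 ≡ (m % 8) * (r * 1 % 8) % 8
  mqs⁴%8 h = mod-* 8 m (q * s ⁴) refl (mod-* 8 q (s ⁴) h (odd⁴ s odd-s))
  no-residue : ∀ r → v ² % 8 ≡ r → r ≢ 0 → r ≢ 1 → r ≢ 4 → ⊥
  no-residue r refl r≢0 r≢1 r≢4 = [ r≢0 , [ r≢1 , r≢4 ]′ ]′ (²-mod-8 v)
  go : Admissible m q → ⊥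
  go one           = no-residue 2 (v²%8 (mqs⁴%8 refl)) (λ ()) (λ ()) (λ ())
  go two           = no-residue 3 (v²%8 (mqs⁴%8 refl)) (λ ()) (λ ()) (λ ())
  go four          = no-residue 5 (v²%8 (mqs⁴%8 refl)) (λ ()) (λ ()) (λ ())
  go (twice _ q≡3) = no-residue 7 (v²%8 (mqs⁴%8 q≡3)) (λ ()) (λ ()) (λ ())

-- Once s = 2 k, `difference-split` applies with 4 m in place of m. Its second outcome coincides
-- with the first if q = 1; if m = 2 and q ≡ 3 modulo 8, it would equate 3 a⁴, which is 0, 3 or 4
-- modulo 8, with t² + 8 b⁴, which is 1.
first-descent : Admissible m q → Odd t → Coprime t (m * (q * s)) → t ⁴ + m * (q * s ⁴) ≡ v ² →
  ∃₂ λ a b → s ≡ 2 * (a * b) × Coprime t (m * (q * b)) × a ⁴ ≡ t ² + 4 * (m * (q * b ⁴))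
first-descent {m} {q} {t} {s} {v} adm odd-t cop eq
  with even-half {s} (even-root {m} {q} {t} {s} {v} adm odd-t eq)
... | k , refl = conclude (difference-split {t = t} {z = k} {v = v} p4m pq (admissible-separated adm) odd-t cop′ eq′)
  where
  instance _ = proj₁ (admissible-nonZero adm)
  instance _ = proj₂ (admissible-nonZero adm)
  instance _ = m*n≢0 4 m
  p4m = proj₁ (proj₂ (admissible-primary adm))
  pq = proj₂ (proj₂ (admissible-primary adm))
  ident : ∀ m q k → m * (q * (2 * k * (2 * k) * (2 * k * (2 * k)))) ≡ 4 * (4 * m * (q * (k * k * (k * k))))
  ident = solve-∀
  eq′ : v ² ≡ t ⁴ + 4 * (4 * m * (q * k ⁴))
  eq′ = trans (sym eq) (cong (t ⁴ +_) (ident m q k))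
  cop′ : Coprime (t ²) (4 * m * (q * k ⁴))
  cop′ = coprime-∣ ∣-refl (subst (4 * m * (q * k ⁴) ∣_) (sym (ident m q k)) (n∣m*n 4))
    (Coprime.sym (coprime-² (Coprime.sym (coprime-⁴-factor m q cop))))
  conclude : (∃₂ λ a b → k ≡ a * b × (a ⁴ ≡ t ² + 4 * m * (q * b ⁴) ⊎ q * a ⁴ ≡ t ² + 4 * m * b ⁴)) →
    ∃₂ λ a b → 2 * k ≡ 2 * (a * b) × Coprime t (m * (q * b)) × a ⁴ ≡ t ² + 4 * (m * (q * b ⁴))
  conclude (a , b , refl , alt) = a , b , refl , cop-b , equation adm alt
    where
    cop-b : Coprime t (m * (q * b))
    cop-b = coprime-∣ ∣-refl (*-monoʳ-∣ m (*-monoʳ-∣ q (∣n⇒∣m*n 2 (n∣m*n a)))) cop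
    unit : q ≡ 1 → q * a ⁴ ≡ t ² + 4 * m * b ⁴ → a ⁴ ≡ t ² + 4 * (m * (q * b ⁴))
    unit refl h = trans (sym (*-identityˡ (a ⁴))) (trans h (cong (t ² +_)
      (trans (*-assoc 4 m (b ⁴)) (cong (λ i → 4 * (m * i)) (sym (*-identityˡ (b ⁴)))))))
    equation : Admissible m q → a ⁴ ≡ t ² + 4 * m * (q * b ⁴) ⊎ q * a ⁴ ≡ t ² + 4 * m * b ⁴ →
               a ⁴ ≡ t ² + 4 * (m * (q * b ⁴))
    equation _    (inj₁ h) = trans h (cong (t ² +_) (*-assoc 4 m (q * b ⁴)))
    equation one  (inj₂ h) = unit refl h
    equation two  (inj₂ h) = unit refl h
    equation four (inj₂ h) = unit refl h
    equation (twice _ q≡3) (inj₂ h) = ⊥-elim (impossible (²-mod-8 (a ²)))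
      where
      residue : a ⁴ % 8 ≡ r → 3 * r % 8 ≡ 1
      residue h′ = trans (sym (mod-* 8 q (a ⁴) q≡3 h′)) (trans (cong (_% 8) h)
        (mod-+ 8 (t ²) (8 * b ⁴) (odd² t odd-t) (mod-* 8 8 (b ⁴) refl refl)))
      impossible : a ⁴ % 8 ≡ 0 ⊎ a ⁴ % 8 ≡ 1 ⊎ a ⁴ % 8 ≡ 4 → ⊥
      impossible (inj₁ h′) = contradiction (residue h′) λ ()
      impossible (inj₂ (inj₁ h′)) = contradiction (residue h′) λ ()
      impossible (inj₂ (inj₂ h′)) = contradiction (residue h′) λ ()

-- The two steps together give s = 2 a d c, where c is the root of a solution of the same quartic.
-- If s is not 0, then c ≤ a d c < s, so c = 0 by induction, and s is 0 after all.
descent : Admissible m q → ∀ s {t v} → Odd t → Coprime t (m * (q * s)) → t ⁴ + m * (q * s ⁴) ≡ v ² → s ≡ 0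
descent {m} {q} adm = <-rec _ step
  where
  P : ℕ → Set
  P s = ∀ {t v} → Odd t → Coprime t (m * (q * s)) → t ⁴ + m * (q * s ⁴) ≡ v ² → s ≡ 0
  step : ∀ s → (∀ {c} → c < s → P c) → P s
  step s rec {t} {v} odd-t cop eq = from-first (first-descent {s = s} {v = v} adm odd-t cop eq)
    where
    vanish : ∀ a d → 2 * (a * (d * 0)) ≡ 0
    vanish = solve-∀
    conclude : ∀ a c d → s ≡ 2 * (a * (d * c)) → (c < s → c ≡ 0) → s ≡ 0
    conclude a c d s≡ ih with s ≟ 0
    ... | yes s≡0 = s≡0
    ... | no  s≢0 = trans s≡ (trans (cong (λ i → 2 * (a * (d * i))) (ih c<s)) (vanish a d))
      where
      half = a * (d * c)
      instance
        half≢0 : NonZero half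
        half≢0 = ≢-nonZero λ half≡0 → s≢0 (trans s≡ (cong (2 *_) half≡0))
      c<s : c < s
      c<s = subst (c <_) (sym s≡) (≤-<-trans (∣⇒≤ (∣n⇒∣m*n a (n∣m*n d)))
              (m<m+n half (subst (0 <_) (sym (+-identityʳ half)) (>-nonZero⁻¹ half))))
    from-second : ∀ a b → s ≡ 2 * (a * b) → Smaller m q a b → s ≡ 0
    from-second a b s≡ (c , d , odd-d , cop-d , eq₂ , b≡) =
      conclude a c d (trans s≡ (cong (λ i → 2 * (a * i)) b≡)) λ c<s → rec c<s {v = a} odd-d cop-d (sym eq₂)
    from-first : (∃₂ λ a b → s ≡ 2 * (a * b) × Coprime t (m * (q * b)) × a ⁴ ≡ t ² + 4 * (m * (q * b ⁴))) → s ≡ 0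
    from-first (a , b , s≡ , cop-b , eq₁) = from-second a b s≡ (second-descent {a = a} adm odd-t cop-b eq₁)

-- Entry into the descent at its intermediate equation. It serves equations with a bare fourth power
-- on the left, such as z⁴ = x⁴ + 8 w⁴, where t = x² and Q = 2.
descent′ : Admissible m q → ∀ a → Odd t → Coprime t (m * (q * b)) → a ⁴ ≡ t ² + 4 * (m * (q * b ⁴)) → b ≡ 0
descent′ {m} {q} {b = b} adm a odd-t cop eq = conclude (second-descent {a = a} adm odd-t cop eq)
  where
  conclude : Smaller m q a b → b ≡ 0
  conclude (c , d , odd-d , cop-d , eq′ , b≡) =
    trans b≡ (trans (cong (d *_) (descent adm c {v = a} odd-d cop-d (sym eq′))) (*-zeroʳ d))

-- Fermat's theorem on differences of fourth powers, reduced to Q = 4. The coprime numbers (y² - x²)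
-- / 2 and (y² + x²) / 2 have product k², so they are squares e² and f²; e is even, since otherwise
-- f² = e² + x² would be 2 modulo 8.
fermat : ∀ y → Odd x → Coprime x k → y ⁴ ≡ x ⁴ + 4 * k ² → k ≡ 0
fermat {x} {k} y odd-x cop eq with difference-of-squares (y ²) (x ²) (k ²) eq
... | i , y²≡ , ij≡ = conclude (square-split {z = k} cop′ ij≡)
  where
  cop′ : Coprime i (i + x ²)
  cop′ {d} (d∣i , d∣i+x²) = Coprime.sym (coprime-² (Coprime.sym (coprime-² cop)))
    (∣m+n∣m⇒∣n d∣i+x² d∣i , subst (d ∣_) ij≡ (∣m⇒∣m*n _ d∣i))
  even-e : ∀ e f → e ² + x ² ≡ f ² → Even e
  even-e e f j≡ with even-or-odd e
  ... | inj₁ even = even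
  ... | inj₂ odd = ⊥-elim (impossible (²-mod-8 f))
    where
    residue : f ² % 8 ≡ r → 2 ≡ r
    residue h = trans (sym (mod-+ 8 (e ²) (x ²) (odd² e odd) (odd² x odd-x))) (trans (cong (_% 8) j≡) h)
    impossible : f ² % 8 ≡ 0 ⊎ f ² % 8 ≡ 1 ⊎ f ² % 8 ≡ 4 → ⊥
    impossible (inj₁ h) = contradiction (residue h) λ ()
    impossible (inj₂ (inj₁ h)) = contradiction (residue h) λ ()
    impossible (inj₂ (inj₂ h)) = contradiction (residue h) λ ()
  conclude : (∃₂ λ e f → i ≡ e ² × i + x ² ≡ f ² × k ≡ e * f) → k ≡ 0
  conclude (e , f , refl , j≡ , refl) with even-half {e} (even-e e f j≡)
  ... | g , refl = cong (λ i → 2 * i * f) (descent′ {b = g} four f odd-xy cop-xy eq′)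
   where
   -- f² = x² + e² and y² = x² + 2 e², so f⁴ = (x y)² + e⁴.
   eq′ : f ⁴ ≡ (x * y) ² + 4 * (4 * (1 * g ⁴))
   eq′ = begin
     f ⁴                                              ≡⟨ cong _² (sym j≡) ⟩
     ((2 * g) ² + x ²) ²                              ≡⟨ ident g x ⟩
     x ² * (x ² + 2 * (2 * g) ²) + 4 * (4 * (1 * g ⁴)) ≡⟨ cong (λ i → x ² * i + 4 * (4 * (1 * g ⁴))) (sym y²≡) ⟩
     x ² * y ² + 4 * (4 * (1 * g ⁴))                  ≡⟨ cong (_+ 4 * (4 * (1 * g ⁴))) (ident′ x y) ⟩
     (x * y) ² + 4 * (4 * (1 * g ⁴))                  ∎
     where
     open ≡-Reasoning
     ident : ∀ g x → (2 * g * (2 * g) + x * x) * (2 * g * (2 * g) + x * x) ≡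
       x * x * (x * x + 2 * (2 * g * (2 * g))) + 4 * (4 * (1 * (g * g * (g * g))))
     ident = solve-∀
     ident′ : ∀ x y → x * x * (y * y) ≡ x * y * (x * y)
     ident′ = solve-∀
   odd-y : Odd y
   odd-y = odd-*ˡ y (trans (cong (_% 2) y²≡) (mod-+ 2 (x ²) (2 * (2 * g) ²) (²-odd x odd-x) (even-* 2 ((2 * g) ²) refl)))
   odd-xy : Odd (x * y)
   odd-xy = mod-* 2 x y odd-x odd-y
   cop-xg : Coprime x g
   cop-xg = coprime-∣ ∣-refl (∣m⇒∣m*n f (n∣m*n 2)) cop
   cop-yg : Coprime y g
   cop-yg {d} (d∣y , d∣g) = Coprime.sym (coprime-² (Coprime.sym cop-xg))
     (∣m+n∣m⇒∣n (subst (d ∣_) (trans y²≡ (+-comm (x ²) _)) (∣m⇒∣m*n y d∣y)) (∣n⇒∣m*n 2 (∣m⇒∣m*n (2 * g) (∣n⇒∣m*n 2 d∣g))) , d∣g)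
   cop-xy : Coprime (x * y) (4 * (1 * g))
   cop-xy = coprime-* (coprime-² (odd⇒coprime-2 {x * y} odd-xy))
     (subst (Coprime (x * y)) (sym (*-identityˡ g)) (coprime-*ˡ cop-xg cop-yg))

-- Quadratic residues

mod-cong-+ : ∀ n .{{_ : NonZero n}} a b c d → a % n ≡ b % n → c % n ≡ d % n → (a + c) % n ≡ (b + d) % n
mod-cong-+ n a b c d ab cd = trans (mod-+ n a c ab cd) (sym (%-distribˡ-+ b d n))

mod-cong-* : ∀ n .{{_ : NonZero n}} a b c d → a % n ≡ b % n → c % n ≡ d % n → (a * c) % n ≡ (b * d) % n
mod-cong-* n a b c d ab cd = trans (mod-* n a c ab cd) (sym (%-distribˡ-* b d n))

²-complement : ∀ n .{{_ : NonZero n}} r s → r + s ≡ n → r ² % n ≡ s ² % n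
²-complement n r s refl = trans (sym ([m+kn]%n≡m%n (r ²) s n))
  (trans (cong (_% n) (ident r s)) ([m+kn]%n≡m%n (s ²) r n))
  where
  ident : ∀ r s → r * r + s * (r + s) ≡ s * s + r * (r + s)
  ident = solve-∀

-- The remainder ρ of x and n - ρ have equal squares modulo n and, n being odd, opposite parities.
representative : ∀ n .{{_ : NonZero n}} → Odd n → ∀ x →
  ∀ e → e ≡ 0 ⊎ e ≡ 1 → ∃ λ r → r ≤ n × r % 2 ≡ e × r ² % n ≡ x ² % n
representative n odd-n x e e≡ = choose e≡ (even-or-odd ρ) (even-or-odd σ)
  where
  ρ = x % n
  σ = n ∸ ρ
  ρ≤n = m%n≤n x n
  ρ+σ≡n : ρ + σ ≡ n
  ρ+σ≡n = m+[n∸m]≡n ρ≤n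
  ρ²≡ : ρ ² % n ≡ x ² % n
  ρ²≡ = sym (%-distribˡ-* x x n)
  σ²≡ : σ ² % n ≡ x ² % n
  σ²≡ = trans (sym (²-complement n ρ σ ρ+σ≡n)) ρ²≡
  odd-ρ+σ : Odd (ρ + σ)
  odd-ρ+σ = subst Odd (sym ρ+σ≡n) odd-n
  choose : e ≡ 0 ⊎ e ≡ 1 → Even ρ ⊎ Odd ρ → Even σ ⊎ Odd σ →
    ∃ λ r → r ≤ n × r % 2 ≡ e × r ² % n ≡ x ² % n
  choose (inj₁ refl) (inj₁ even) _ = ρ , ρ≤n , even , ρ²≡
  choose (inj₁ refl) _ (inj₁ even) = σ , m∸n≤m n ρ , even , σ²≡
  choose (inj₁ refl) (inj₂ odd) (inj₂ odd′) = ⊥-elim (¬even∧odd {ρ + σ} (mod-+ 2 ρ σ odd odd′) odd-ρ+σ)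
  choose (inj₂ refl) (inj₂ odd) _ = ρ , ρ≤n , odd , ρ²≡
  choose (inj₂ refl) _ (inj₂ odd) = σ , m∸n≤m n ρ , odd , σ²≡
  choose (inj₂ refl) (inj₁ even) (inj₁ even′) = ⊥-elim (¬even∧odd {ρ + σ} (mod-+ 2 ρ σ even even′) odd-ρ+σ)

-- In ℕ, Bézout's identity comes in two forms, y y′ ≡ 1 and y y′ ≡ -1 modulo p. Squaring makes them
-- agree, and only squares of inverses are needed.
inverse-up-to-sign : Prime p → .{{_ : NonZero p}} → p ∤ y → ∃ λ y′ → (y * y′) ² % p ≡ 1 % p
inverse-up-to-sign {p} {y} pr p∤y with coprime-Bézout (∤⇒coprime pr p∤y)
... | Bézout.+- i y′ eq = y′ , trans (sym ([m+kn]%n≡m%n ((y * y′) ²) i p))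
        (trans (cong (_% p) rearranged) ([m+kn]%n≡m%n 1 (y * y′ * i) p))
  where
  rearranged : (y * y′) ² + i * p ≡ 1 + y * y′ * i * p
  rearranged = begin
    (y * y′) ² + i * p            ≡⟨ cong ((y * y′) ² +_) (sym eq) ⟩
    (y * y′) ² + (1 + y′ * y)     ≡⟨ ident y y′ ⟩
    1 + y * y′ * (1 + y′ * y)     ≡⟨ cong (λ k → 1 + y * y′ * k) eq ⟩
    1 + y * y′ * (i * p)          ≡⟨ cong (1 +_) (sym (*-assoc (y * y′) i p)) ⟩
    1 + y * y′ * i * p            ∎
    where
    open ≡-Reasoning
    ident : ∀ y z → y * z * (y * z) + (1 + z * y) ≡ 1 + y * z * (1 + z * y)
    ident = solve-∀
... | Bézout.-+ i y′ eq = y′ , trans (cong (_% p) rearranged) ([m+kn]%n≡m%n 1 (2 * i + i * i * p) p)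
  where
  rearranged : (y * y′) ² ≡ 1 + (2 * i + i * i * p) * p
  rearranged = trans (cong _² (trans (*-comm y y′) (sym eq))) (ident i p)
    where
    ident : ∀ i p → (1 + i * p) * (1 + i * p) ≡ 1 + (2 * i + i * i * p) * p
    ident = solve-∀

-- Descent on n: for a root x < n of parity e, the cofactor k in x² + j = i + k n is less than n
-- and again has residue α or β modulo 8.
module Nonresidue (i j e α β : ℕ) (i≤2 : i ≤ 2) (j≤2 : j ≤ 2) (i≢j : i ≢ j)
  (e≡ : e ≡ 0 ⊎ e ≡ 1) (3≤α : 3 ≤ α) (3≤β : 3 ≤ β) (odd-α : Odd α) (odd-β : Odd β)
  (table : ∀ {κ} → κ < 8 → ∀ {ρ} → ρ < 8 → ρ % 2 ≡ e →
    ((i + κ * α) % 8 ≡ (ρ * ρ + j) % 8 → κ ≡ α ⊎ κ ≡ β) ×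
    ((i + κ * β) % 8 ≡ (ρ * ρ + j) % 8 → κ ≡ α ⊎ κ ≡ β))
  where

  Excluded : ℕ → Set
  Excluded n = n % 8 ≡ α ⊎ n % 8 ≡ β

  excluded⇒≥3 : ∀ n → Excluded n → 3 ≤ n
  excluded⇒≥3 n (inj₁ h) = ≤-trans 3≤α (subst (_≤ n) h (m%n≤m n 8))
  excluded⇒≥3 n (inj₂ h) = ≤-trans 3≤β (subst (_≤ n) h (m%n≤m n 8))

  excluded⇒odd : ∀ n → Excluded n → Odd n
  excluded⇒odd n (inj₁ h) = mod-8⇒odd n h odd-α
  excluded⇒odd n (inj₂ h) = mod-8⇒odd n h odd-β

  cofactor-excluded : ∀ n k r → Excluded n → r % 2 ≡ e → r ² + j ≡ i + k * n → Excluded k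
  cofactor-excluded n k r ex r%2 eq = go ex
    where
    entry = table (m%n<n k 8) (m%n<n r 8) (trans (m∣n⇒o%n%m≡o%m 2 8 r (divides 4 refl)) r%2)
    congruence : n % 8 ≡ m → (i + k % 8 * m) % 8 ≡ (r % 8 * (r % 8) + j) % 8
    congruence refl = trans
      (mod-cong-+ 8 i i (k % 8 * (n % 8)) (k * n) refl (sym (%-distribˡ-* k n 8)))
      (trans (cong (_% 8) (sym eq))
      (mod-cong-+ 8 (r ²) (r % 8 * (r % 8)) j j (%-distribˡ-* r r 8) refl))
    go : Excluded n → Excluded k
    go (inj₁ h) = proj₁ entry (congruence h)
    go (inj₂ h) = proj₂ entry (congruence h)

  cofactor-< : ∀ n k r → 3 ≤ n → r < n → r ² + j ≡ i + k * n → k < n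
  cofactor-< n k r 3≤n r<n eq = *-cancelʳ-< n k n (≤-<-trans (m≤n+m (k * n) i) (subst (_< n * n) eq (bound r r<n)))
    where
    ident : ∀ r → (1 + r) * (1 + r) + 2 + (1 + 2 * r) ≡ (2 + r) * (2 + r)
    ident = solve-∀
    bound : ∀ r → r < n → r ² + j < n * n
    bound zero    _   = <-≤-trans (s≤s j≤2) (≤-trans 3≤n (m≤m*n n n {{>-nonZero (≤-trans (s≤s z≤n) 3≤n)}}))
    bound (suc r) r<n = <-≤-trans (≤-<-trans (+-monoʳ-≤ _ j≤2)
      (subst ((1 + r) * (1 + r) + 2 <_) (ident r) (m<m+n _ (s≤s z≤n)))) (*-mono-≤ r<n r<n)

  -- Stated for composite n as well, since the cofactor κ need not be prime. The number r is again a
  -- root modulo κ because r² + j = i + κ n is symmetric in n and κ.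
  no-root : ∀ n .{{_ : NonZero n}} → Excluded n → ∀ x → (x ² + j) % n ≢ i % n
  no-root = <-rec _ step
    where
    P : ℕ → Set
    P n = .{{_ : NonZero n}} → Excluded n → ∀ x → (x ² + j) % n ≢ i % n
    step : ∀ n → (∀ {k} → k < n → P k) → P n
    step n rec ex x eq = conclude (representative n (excluded⇒odd n ex) x e e≡)
      where
      3≤n = excluded⇒≥3 n ex
      i<n = ≤-trans (s≤s i≤2) 3≤n
      j<n = ≤-trans (s≤s j≤2) 3≤n
      conclude : (∃ λ r → r ≤ n × r % 2 ≡ e × r ² % n ≡ x ² % n) → ⊥
      conclude (r , r≤n , r%2 , r²) =
        rec {κ} (cofactor-< n κ r 3≤n (≤∧≢⇒< r≤n r≢n) factor) {{k≢0}} ex-k r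
          (trans (cong (λ h → (h % κ) {{k≢0}}) factor′) ([m+kn]%n≡m%n i n κ {{k≢0}}))
        where
        κ = (r ² + j) / n
        root : (r ² + j) % n ≡ i
        root = trans (mod-cong-+ n (r ²) (x ²) j j r² refl) (trans eq (m<n⇒m%n≡m i<n))
        factor : r ² + j ≡ i + κ * n
        factor = trans (m≡m%n+[m/n]*n (r ² + j) n) (cong (_+ κ * n) root)
        factor′ : r ² + j ≡ i + n * κ
        factor′ = trans factor (cong (i +_) (*-comm κ n))
        ex-k = cofactor-excluded n κ r ex r%2 factor
        k≢0 : NonZero κ
        k≢0 = >-nonZero (≤-trans (s≤s z≤n) (excluded⇒≥3 κ ex-k))
        -- If r were n, then j ≡ i modulo n, although i and j are different and both at most 2 < n.
        r≢n : r ≢ n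
        r≢n refl = i≢j (trans (sym root) (trans (%-remove-+ˡ j (m∣m*n n)) (m<n⇒m%n≡m j<n)))

  -- Division by y modulo p turns the equation into a root x / y; the sign of the inverse is
  -- immaterial because x / y is squared.
  no-ratio : Prime p → Excluded p → ∀ x y k → p ∤ y → x ² + j * y ² ≢ i * y ² + k * p
  no-ratio {p} pr ex x y k p∤y eq = go (inverse-up-to-sign pr p∤y)
    where
    instance _ = prime⇒nonZero pr
    go : (∃ λ y′ → (y * y′) ² % p ≡ 1 % p) → ⊥
    go (y′ , inv) = no-root p ex (x * y′) (begin
      ((x * y′) ² + j) % p              ≡⟨ mod-cong-+ p ((x * y′) ²) _ j (j * E) refl (times-E j) ⟩
      ((x * y′) ² + j * E) % p          ≡⟨ cong (_% p) (ident₁ x y y′ j) ⟩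
      ((x ² + j * y ²) * y′ ²) % p      ≡⟨ cong (λ h → h * y′ ² % p) eq ⟩
      ((i * y ² + k * p) * y′ ²) % p    ≡⟨ cong (_% p) (ident₂ y y′ i k p) ⟩
      (i * E + k * y′ ² * p) % p        ≡⟨ [m+kn]%n≡m%n (i * E) (k * y′ ²) p ⟩
      (i * E) % p                       ≡⟨ sym (times-E i) ⟩
      i % p                             ∎)
      where
      open ≡-Reasoning
      E = (y * y′) ²
      times-E : ∀ h → h % p ≡ (h * E) % p
      times-E h = trans (cong (_% p) (sym (*-identityʳ h))) (mod-cong-* p h h 1 E refl (sym inv))
      ident₁ : ∀ x y z j → x * z * (x * z) + j * (y * z * (y * z)) ≡ (x * x + j * (y * y)) * (z * z)
      ident₁ = solve-∀
      ident₂ : ∀ y z i k p → (i * (y * y) + k * p) * (z * z) ≡ i * (y * z * (y * z)) + k * (z * z) * p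
      ident₂ = solve-∀

-- Here and in the next two modules the parity e pins down the product κ n: an odd x gives x² - 2 ≡
-- 7 and x² + 2 ≡ 3 modulo 8, an even x gives x² + 1 ≡ 1 modulo 4. Hence κ has residue α or β
-- whenever n has.
module √2 = Nonresidue 2 0 1 3 5 (s≤s (s≤s z≤n)) z≤n (λ ()) (inj₂ refl)
  (s≤s (s≤s (s≤s z≤n))) (s≤s (s≤s (s≤s z≤n))) refl refl
  (from-yes (allUpTo? (λ κ → allUpTo? (λ ρ → (ρ % 2 ≟ 1) →-dec
    ((((2 + κ * 3) % 8 ≟ (ρ * ρ + 0) % 8) →-dec ((κ ≟ 3) ⊎-dec (κ ≟ 5))) ×-dec
     (((2 + κ * 5) % 8 ≟ (ρ * ρ + 0) % 8) →-dec ((κ ≟ 3) ⊎-dec (κ ≟ 5))))) 8) 8))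

module √-1 = Nonresidue 0 1 0 3 7 z≤n (s≤s z≤n) (λ ()) (inj₁ refl)
  (s≤s (s≤s (s≤s z≤n))) (s≤s (s≤s (s≤s z≤n))) refl refl
  (from-yes (allUpTo? (λ κ → allUpTo? (λ ρ → (ρ % 2 ≟ 0) →-dec
    ((((0 + κ * 3) % 8 ≟ (ρ * ρ + 1) % 8) →-dec ((κ ≟ 3) ⊎-dec (κ ≟ 7))) ×-dec
     (((0 + κ * 7) % 8 ≟ (ρ * ρ + 1) % 8) →-dec ((κ ≟ 3) ⊎-dec (κ ≟ 7))))) 8) 8))

module √-2 = Nonresidue 0 2 1 5 7 z≤n (s≤s (s≤s z≤n)) (λ ()) (inj₂ refl)
  (s≤s (s≤s (s≤s z≤n))) (s≤s (s≤s (s≤s z≤n))) refl refl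
  (from-yes (allUpTo? (λ κ → allUpTo? (λ ρ → (ρ % 2 ≟ 1) →-dec
    ((((0 + κ * 5) % 8 ≟ (ρ * ρ + 2) % 8) →-dec ((κ ≟ 5) ⊎-dec (κ ≟ 7))) ×-dec
     (((0 + κ * 7) % 8 ≟ (ρ * ρ + 2) % 8) →-dec ((κ ≟ 5) ⊎-dec (κ ≟ 7))))) 8) 8))

no-√2 : Prime p → p % 8 ≡ 3 ⊎ p % 8 ≡ 5 → ∀ x y k → p ∤ y → x ² ≢ 2 * y ² + k * p
no-√2 pr p%8 x y k p∤y eq = √2.no-ratio pr p%8 x y k p∤y (trans (+-identityʳ (x ²)) eq)

no-√-1 : Prime p → p % 8 ≡ 3 → ∀ x y → p ∤ y → p ∤ x ² + y ²
no-√-1 pr p%8 x y p∤y (divides k eq) = √-1.no-ratio pr (inj₁ p%8) x y k p∤y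
  (trans (cong (x ² +_) (*-identityˡ (y ²))) eq)

no-√-2 : Prime p → p % 8 ≡ 5 → ∀ x y → p ∤ y → p ∤ x ² + 2 * y ²
no-√-2 pr p%8 x y p∤y (divides k eq) = √-2.no-ratio pr (inj₁ p%8) x y k p∤y eq

-- Two quartics t⁴ + κ p² s⁴ simultaneously

-- x / y and w / z are the same fraction in lowest terms.
exchange : Coprime x y → Coprime z w → x * z ≡ y * w → x ≡ w
exchange {x} {y} {z} {w} xy zw eq = ∣-antisym
  (coprime-divisor xy (subst (x ∣_) eq (m∣m*n z)))
  (coprime-divisor (Coprime.sym zw) (subst (w ∣_) (trans (sym eq) (*-comm x z)) (n∣m*n y)))

-- The common refinement of two factorisations of one number: x is gcd a c, and y / z is a / c in
-- lowest terms.
four-numbers : .{{_ : NonZero a}} .{{_ : NonZero c}} → a * b ≡ c * d →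
  ∃₂ λ x y → ∃₂ λ z w → a ≡ y * x × b ≡ z * w × c ≡ z * x × d ≡ y * w × Coprime y z
four-numbers {a} {c} {b} {d} eq with lowest-terms a c
... | x , y , z , x≢0 , a≡ , c≡ , cop = conclude z∣b
  where
  instance _ = x≢0
  z≢0 : NonZero z
  z≢0 = ≢-nonZero λ z≡0 → ≢-nonZero⁻¹ c (trans c≡ (cong (_* x) z≡0))
  yb≡zd : y * b ≡ z * d
  yb≡zd = *-cancelˡ-≡ _ _ x (trans (ident x y b) (trans (cong (_* b) (sym a≡))
    (trans eq (trans (cong (_* d) c≡) (sym (ident x z d))))))
    where
    ident : ∀ x y b → x * (y * b) ≡ y * x * b
    ident = solve-∀
  z∣b : z ∣ b
  z∣b = coprime-divisor (Coprime.sym cop) (subst (z ∣_) (sym yb≡zd) (m∣m*n d))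
  conclude : z ∣ b → ∃₂ λ x y → ∃₂ λ z w → a ≡ y * x × b ≡ z * w × c ≡ z * x × d ≡ y * w × Coprime y z
  conclude (divides w b≡) = x , y , z , w , a≡ , trans b≡ (*-comm w z) , c≡ , d≡ , cop
    where
    ident : ∀ y z w → y * (w * z) ≡ z * (y * w)
    ident = solve-∀
    d≡ : d ≡ y * w
    d≡ = *-cancelˡ-≡ _ _ z {{z≢0}} (trans (sym yb≡zd) (trans (cong (y *_) b≡) (ident y z w)))

-- A common divisor of x⁴ + 8 K and x⁴ + m K divides 8 K, whether m = 4 or m = 16, and therefore
-- also x⁴, which is coprime to 8 K. Thus the equation compares two fractions in lowest terms.
cross : ∀ l l′ → m ≡ 4 ⊎ m ≡ 16 → Odd x → Coprime x (r * w) → Coprime l l′ →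
  l * (x ⁴ + 8 * (r ² * w ⁴)) ≡ l′ * (x ⁴ + m * (r ² * w ⁴)) →
  l ≡ x ⁴ + m * (r ² * w ⁴) × l′ ≡ x ⁴ + 8 * (r ² * w ⁴)
cross {m} {x} {r} {w} l l′ m≡ odd-x cop ll′ eq =
  exchange ll′ coprime-R-S eq , exchange (Coprime.sym ll′) (Coprime.sym coprime-R-S) (sym eq)
  where
  K = r ² * w ⁴
  R = x ⁴ + 8 * K
  S = x ⁴ + m * K
  coprime-x⁴ : Coprime (x ⁴) (8 * K)
  coprime-x⁴ = Coprime.sym (coprime-⁴ (Coprime.sym
    (coprime-* {b = 8} (Coprime.sym (coprime-^ 3 (Coprime.sym (odd⇒coprime-2 {x} odd-x))))
      (coprime-* {b = r ²} (coprime-² {b = r} (coprime-∣ ∣-refl (m∣m*n w) cop)) (coprime-⁴ (coprime-∣ ∣-refl (n∣m*n r) cop))))))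
  ident : ∀ x k → x + 4 * k + 4 * k ≡ x + 8 * k
  ident = solve-∀
  ident′ : ∀ x k → x + 8 * k + 8 * k ≡ x + 16 * k
  ident′ = solve-∀
  ∣8K : ∀ {e} → m ≡ 4 ⊎ m ≡ 16 → e ∣ R → e ∣ S → e ∣ 8 * K
  ∣8K {e} (inj₁ refl) e∣R e∣S = subst (e ∣_) (sym (*-assoc 2 4 K))
    (∣n⇒∣m*n 2 (∣m+n∣m⇒∣n (subst (e ∣_) (sym (ident (x ⁴) K)) e∣R) e∣S))
  ∣8K {e} (inj₂ refl) e∣R e∣S = ∣m+n∣m⇒∣n (subst (e ∣_) (sym (ident′ (x ⁴) K)) e∣S) e∣R
  coprime-R-S : Coprime R S
  coprime-R-S {e} (e∣R , e∣S) = coprime-x⁴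
    (∣m+n∣m⇒∣n (subst (e ∣_) (+-comm (x ⁴) (8 * K)) e∣R) (∣8K m≡ e∣R e∣S) , ∣8K m≡ e∣R e∣S)

-- α and γ are the coefficients, 1 or p², of the fourth powers on the left, and ρ is chosen so that
-- α γ ρ = p². This writes all three distributions of p² in one form; T stands for the eliminated
-- t².
eliminate : ∀ α γ ρ m T x y z w →
  α * (y * x) ⁴ ≡ T + m * (γ * ρ * (z * w) ⁴) → γ * (z * x) ⁴ ≡ T + 8 * (α * ρ * (y * w) ⁴) →
  α * y ⁴ * (x ⁴ + 8 * (ρ * w ⁴)) ≡ γ * z ⁴ * (x ⁴ + m * (ρ * w ⁴))
eliminate α γ ρ m T x y z w eq₁ eq₂ = begin
  α * y ⁴ * (x ⁴ + 8 * (ρ * w ⁴))                                ≡⟨ expand α ρ 8 x y w ⟩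
  α * (y * x) ⁴ + 8 * (α * ρ * (y * w) ⁴)                        ≡⟨ cong (_+ 8 * (α * ρ * (y * w) ⁴)) eq₁ ⟩
  T + m * (γ * ρ * (z * w) ⁴) + 8 * (α * ρ * (y * w) ⁴)          ≡⟨ swap T (m * (γ * ρ * (z * w) ⁴)) (8 * (α * ρ * (y * w) ⁴)) ⟩
  T + 8 * (α * ρ * (y * w) ⁴) + m * (γ * ρ * (z * w) ⁴)          ≡⟨ cong (_+ m * (γ * ρ * (z * w) ⁴)) (sym eq₂) ⟩
  γ * (z * x) ⁴ + m * (γ * ρ * (z * w) ⁴)                        ≡⟨ sym (expand γ ρ m x z w) ⟩
  γ * z ⁴ * (x ⁴ + m * (ρ * w ⁴))                                ∎
  where
  open ≡-Reasoning
  swap : ∀ a b c → a + b + c ≡ a + c + b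
  swap = solve-∀
  expand : ∀ α ρ m x y w →
    α * (y * y * (y * y)) * (x * x * (x * x) + m * (ρ * (w * w * (w * w)))) ≡
    α * (y * x * (y * x) * (y * x * (y * x))) + m * (α * ρ * (y * w * (y * w) * (y * w * (y * w))))
  expand = solve-∀

-- The match gives y⁴ = x⁴ + m r² w⁴, whose last term is 4 k² with k = r w² for m = 4 and k = 2 r w²
-- for m = 16.
cross-fermat : ∀ y l′ .{{_ : NonZero r}} → m ≡ 4 ⊎ m ≡ 16 → Odd x → Coprime x (r * w) → Coprime (y ⁴) l′ →
  y ⁴ * (x ⁴ + 8 * (r ² * w ⁴)) ≡ l′ * (x ⁴ + m * (r ² * w ⁴)) → w ≡ 0
cross-fermat {r} {m} {x} {w} y l′ m≡ odd-x cop ll′ eq = go m≡ (proj₁ (cross {r = r} {w} (y ⁴) l′ m≡ odd-x cop ll′ eq))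
  where
  cop′ : Coprime x (r * w ²)
  cop′ = coprime-* {b = r} (coprime-∣ ∣-refl (m∣m*n w) cop) (coprime-² (coprime-∣ ∣-refl (n∣m*n r) cop))
  root-zero : r * w ² ≡ 0 → w ≡ 0
  root-zero h = reduce (m*n≡0⇒m≡0∨n≡0 w (m*n≡0⇒n≡0 r h))
    where
    m*n≡0⇒n≡0 : ∀ r .{{_ : NonZero r}} → r * n ≡ 0 → n ≡ 0
    m*n≡0⇒n≡0 r h = [ (λ r≡0 → ⊥-elim (≢-nonZero⁻¹ r r≡0)) , (λ h → h) ]′ (m*n≡0⇒m≡0∨n≡0 r h)
  ident₄ : ∀ r w → 4 * (r * r * (w * w * (w * w))) ≡ 4 * (r * (w * w) * (r * (w * w)))
  ident₄ = solve-∀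
  ident₁₆ : ∀ r w → 16 * (r * r * (w * w * (w * w))) ≡ 4 * (2 * (r * (w * w)) * (2 * (r * (w * w))))
  ident₁₆ = solve-∀
  go : m ≡ 4 ⊎ m ≡ 16 → y ⁴ ≡ x ⁴ + m * (r ² * w ⁴) → w ≡ 0
  go (inj₁ refl) h = root-zero (fermat y odd-x cop′ (trans h (cong (x ⁴ +_) (ident₄ r w))))
  go (inj₂ refl) h = root-zero ([ (λ ()) , (λ h → h) ]′ (m*n≡0⇒m≡0∨n≡0 2
    (fermat {k = 2 * (r * w ²)} y odd-x (coprime-* (odd⇒coprime-2 {x} odd-x) cop′)
      (trans h (cong (x ⁴ +_) (ident₁₆ r w))))))

coprime-root : ∀ a b → Prime p → Even m → Odd t → p ∤ t → Coprime t (a * b) →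
  a ⁴ ≡ t ² + m * (p ² * b ⁴) → Odd a × Coprime a (p * b)
coprime-root {p} {m} {t} a b pr even-m odd-t p∤t cop eq = odd-a , coprime-* cop-p cop-b
  where
  odd-a : Odd a
  odd-a = odd-⁴ a (trans (cong (_% 2) eq)
    (mod-+ 2 (t ²) (m * (p ² * b ⁴)) (²-odd t odd-t) (even-* m (p ² * b ⁴) even-m)))
  ∣t² : ∀ {e} → e ∣ a → e ∣ m * (p ² * b ⁴) → e ∣ t ²
  ∣t² {e} e∣a h = ∣m+n∣m⇒∣n (subst (e ∣_) (trans eq (+-comm (t ²) _)) (∣m⇒∣m*n (a ²) (∣m⇒∣m*n a e∣a))) h
  cop-p : Coprime a p
  cop-p = Coprime.sym (∤⇒coprime pr λ p∣a → p∤t (prime∣²⇒∣ {n = t} pr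
    (∣t² p∣a (∣n⇒∣m*n m (∣m⇒∣m*n (b ⁴) (m∣m*n p))))))
  cop-b : Coprime a b
  cop-b (e∣a , e∣b) = Coprime.sym (coprime-² (Coprime.sym cop))
    (∣t² e∣a (∣n⇒∣m*n m (∣n⇒∣m*n (p ²) (∣m⇒∣m*n (b ²) (∣m⇒∣m*n b e∣b)))) , ∣m⇒∣m*n b e∣a)

module _ (pr : Prime p) (m≡ : m ≡ 4 ⊎ m ≡ 16) (odd-t : Odd t) (p∤t : p ∤ t) (cop : Coprime t r) (r≢0 : r ≢ 0) where

  private
    instance _ = prime⇒nonZero pr

    even-m : m ≡ 4 ⊎ m ≡ 16 → Even m
    even-m (inj₁ refl) = refl
    even-m (inj₂ refl) = refl

    nonZeroˡ : r ≡ a * b → NonZero a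
    nonZeroˡ {b = b} r≡ = ≢-nonZero λ a≡0 → r≢0 (trans r≡ (cong (_* b) a≡0))

    w≢0 : r ≡ a * (z * w) → w ≢ 0
    w≢0 {a} {z} r≡ refl = r≢0 (trans r≡ (trans (cong (a *_) (*-zeroʳ z)) (*-zeroʳ a)))

    1*1* : ∀ p n → 1 * (p * p) * n ≡ p * p * n
    1*1* = solve-∀

    p²*1* : ∀ p n → p * p * 1 * n ≡ p * p * n
    p²*1* = solve-∀

    drop-1 : ∀ n → 1 * 1 * n ≡ n
    drop-1 = solve-∀

  -- In the three cases below, 1 * n and 1 ² occur only to match the pattern of `eliminate`.
  incompatible₁₁ : ∀ a b c d → r ≡ a * b → r ≡ c * d →
    a ⁴ ≡ t ² + m * (p ² * b ⁴) → c ⁴ ≡ t ² + 8 * (p ² * d ⁴) → ⊥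
  incompatible₁₁ a b c d r≡ab r≡cd eq₁ eq₂ =
    go (four-numbers {{nonZeroˡ r≡ab}} {{nonZeroˡ r≡cd}} (trans (sym r≡ab) r≡cd))
    where
    go : (∃₂ λ x y → ∃₂ λ z w → a ≡ y * x × b ≡ z * w × c ≡ z * x × d ≡ y * w × Coprime y z) → ⊥
    go (x , y , z , w , refl , refl , refl , refl , yz) =
      w≢0 {y * x} {z} {w} r≡ab (cross-fermat {r = p} {x = x} {w} y (z ⁴) m≡ (odd-*ʳ y (proj₁ root))
        (coprime-∣ (n∣m*n y) (*-monoʳ-∣ p (n∣m*n z)) (proj₂ root))
        (Coprime.sym (coprime-⁴ (Coprime.sym (coprime-⁴ yz))))
        (subst₂ (λ i j → i * (x ⁴ + 8 * (p ² * w ⁴)) ≡ j * (x ⁴ + m * (p ² * w ⁴))) (*-identityˡ (y ⁴)) (*-identityˡ (z ⁴))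
          (eliminate 1 1 (p ²) m (t ²) x y z w
            (trans (*-identityˡ _) (trans eq₁ (cong (λ i → t ² + m * i) (sym (1*1* p ((z * w) ⁴))))))
            (trans (*-identityˡ _) (trans eq₂ (cong (λ i → t ² + 8 * i) (sym (1*1* p ((y * w) ⁴)))))))))
      where
      root = coprime-root {m = m} (y * x) (z * w) pr (even-m m≡) odd-t p∤t (subst (Coprime t) r≡ab cop) eq₁

  -- The factor p² now stays beside z⁴, so the match for y⁴ is still a difference of fourth powers.
  -- That y is coprime to p can be read off from the first equation, where y divides a.
  incompatible₁₂ : ∀ a b c d → r ≡ a * b → r ≡ c * d →
    a ⁴ ≡ t ² + m * (p ² * b ⁴) → p ² * c ⁴ ≡ t ² + 8 * d ⁴ → ⊥
  incompatible₁₂ a b c d r≡ab r≡cd eq₁ eq₂ =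
    go (four-numbers {{nonZeroˡ r≡ab}} {{nonZeroˡ r≡cd}} (trans (sym r≡ab) r≡cd))
    where
    go : (∃₂ λ x y → ∃₂ λ z w → a ≡ y * x × b ≡ z * w × c ≡ z * x × d ≡ y * w × Coprime y z) → ⊥
    go (x , y , z , w , refl , refl , refl , refl , yz) =
      w≢0 {y * x} {z} {w} r≡ab (cross-fermat {r = 1} {x = x} {w} y (p ² * z ⁴) m≡ (odd-*ʳ y (proj₁ root))
        (coprime-∣ (n∣m*n y) (subst (_∣ p * (z * w)) (sym (*-identityˡ w)) (∣n⇒∣m*n p (n∣m*n z))) (proj₂ root))
        (Coprime.sym (coprime-⁴ (Coprime.sym (coprime-* (coprime-² cop-yp) (coprime-⁴ yz)))))
        (subst (λ i → i * (x ⁴ + 8 * (1 ² * w ⁴)) ≡ p ² * z ⁴ * (x ⁴ + m * (1 ² * w ⁴))) (*-identityˡ (y ⁴))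
          (eliminate 1 (p ²) (1 ²) m (t ²) x y z w
            (trans (*-identityˡ _) (trans eq₁ (cong (λ i → t ² + m * i) (sym (p²*1* p ((z * w) ⁴))))))
            (trans eq₂ (cong (λ i → t ² + 8 * i) (sym (drop-1 ((y * w) ⁴))))))))
      where
      root = coprime-root {m = m} (y * x) (z * w) pr (even-m m≡) odd-t p∤t (subst (Coprime t) r≡ab cop) eq₁
      cop-yp : Coprime y p
      cop-yp = coprime-∣ (m∣m*n x) (m∣m*n (z * w)) (proj₂ root)

  -- Here p² stands beside y⁴, so the match for y is no difference of fourth powers; the match for
  -- z⁴ is used instead, and it is the intermediate equation for Q = 2.
  incompatible₂₁ : ∀ a b c d → r ≡ a * b → r ≡ c * d →
    p ² * a ⁴ ≡ t ² + m * b ⁴ → c ⁴ ≡ t ² + 8 * (p ² * d ⁴) → ⊥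
  incompatible₂₁ a b c d r≡ab r≡cd eq₁ eq₂ =
    go (four-numbers {{nonZeroˡ r≡ab}} {{nonZeroˡ r≡cd}} (trans (sym r≡ab) r≡cd))
    where
    go : (∃₂ λ x y → ∃₂ λ z w → a ≡ y * x × b ≡ z * w × c ≡ z * x × d ≡ y * w × Coprime y z) → ⊥
    go (x , y , z , w , refl , refl , refl , refl , yz) =
      w≢0 {y * x} {z} {w} r≡ab (descent′ {b = w} two z (mod-* 2 x x odd-x odd-x)
          (coprime-* {b = 2} (odd⇒coprime-2 {x ²} (mod-* 2 x x odd-x odd-x)) (Coprime.sym (coprime-² (Coprime.sym cop-x))))
          (trans z⁴≡ (cong (x ⁴ +_) (ident w))))
      where
      root = coprime-root {m = 8} (z * x) (y * w) pr refl odd-t p∤t (subst (Coprime t) r≡cd cop) eq₂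
      odd-x : Odd x
      odd-x = odd-*ʳ z (proj₁ root)
      cop-zp : Coprime z p
      cop-zp = coprime-∣ (m∣m*n x) (m∣m*n (y * w)) (proj₂ root)
      cop-x : Coprime x (1 * w)
      cop-x = coprime-∣ (n∣m*n z) (subst (_∣ p * (y * w)) (sym (*-identityˡ w)) (∣n⇒∣m*n p (n∣m*n y))) (proj₂ root)
      z⁴≡ : z ⁴ ≡ x ⁴ + 8 * (1 ² * w ⁴)
      z⁴≡ = proj₂ (cross {r = 1} {w = w} (p ² * y ⁴) (z ⁴) m≡ odd-x cop-x
        (coprime-*ˡ (Coprime.sym (coprime-² (Coprime.sym (coprime-⁴ (Coprime.sym cop-zp)))))
                    (Coprime.sym (coprime-⁴ (Coprime.sym (coprime-⁴ yz)))))
        (subst (λ i → p ² * y ⁴ * (x ⁴ + 8 * (1 ² * w ⁴)) ≡ i * (x ⁴ + m * (1 ² * w ⁴))) (*-identityˡ (z ⁴))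
          (eliminate (p ²) 1 (1 ²) m (t ²) x y z w
            (trans eq₁ (cong (λ i → t ² + m * i) (sym (drop-1 ((z * w) ⁴)))))
            (trans (*-identityˡ _) (trans eq₂ (cong (λ i → t ² + 8 * i) (sym (p²*1* p ((y * w) ⁴)))))))))
      ident : ∀ w → 8 * (1 * 1 * (w * w * (w * w))) ≡ 4 * (2 * (1 * (w * w * (w * w))))
      ident = solve-∀

mod-8⇒odd-prime : p % 8 ≡ 3 ⊎ p % 8 ≡ 5 → Odd p
mod-8⇒odd-prime {p} (inj₁ h) = mod-8⇒odd p h refl
mod-8⇒odd-prime {p} (inj₂ h) = mod-8⇒odd p h refl

-- Each equation splits with p² on either side. As m b⁴ is a square and 8 d⁴ is twice a square, p²
-- a⁴ = t² + m b⁴ makes -1 a square modulo p, and p² c⁴ = t² + 8 d⁴ makes -2 one. The former is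
-- impossible for p ≡ 3, the latter for p ≡ 5 modulo 8, so at least one p² stays on the right and
-- three combinations remain.
simultaneous : Prime p → p % 8 ≡ 3 ⊎ p % 8 ≡ 5 → m ≡ 4 ⊎ m ≡ 16 → Odd t → p ∤ t → Coprime t r →
  ∀ u v → u ² ≡ t ⁴ + 4 * (m * (p ² * r ⁴)) → v ² ≡ t ⁴ + 4 * (8 * (p ² * r ⁴)) → r ≡ 0
simultaneous {p} {m} {t} {r} pr p%8 m≡ odd-t p∤t cop u v equ eqv = conclude (r ≟ 0)
  where
  instance
    _ = prime⇒nonZero pr
    _ = m*n≢0 p p
  primary-p² : Primary (p ²)
  primary-p² = subst Primary (cong (p *_) (*-identityʳ p)) (primary-^ pr 2)
  primary-m : m ≡ 4 ⊎ m ≡ 16 → Primary m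
  primary-m (inj₁ refl) = primary-^ prime[2] 2
  primary-m (inj₂ refl) = primary-^ prime[2] 4
  m≢0 : m ≡ 4 ⊎ m ≡ 16 → NonZero m
  m≢0 (inj₁ refl) = _
  m≢0 (inj₂ refl) = _
  m%4 : m ≡ 4 ⊎ m ≡ 16 → m % 4 ≡ 0
  m%4 (inj₁ refl) = refl
  m%4 (inj₂ refl) = refl
  p²%4 : p ² % 4 ≡ 1
  p²%4 = trans (sym (m∣n⇒o%n%m≡o%m 4 8 (p ²) (divides 2 refl)))
    (cong (_% 4) (odd² p (mod-8⇒odd-prime {p} p%8)))
  cop-m : m ≡ 4 ⊎ m ≡ 16 → Coprime t m
  cop-m (inj₁ refl) = Coprime.sym (coprime-^ 2 (Coprime.sym (odd⇒coprime-2 {t} odd-t)))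
  cop-m (inj₂ refl) = Coprime.sym (coprime-^ 4 (Coprime.sym (odd⇒coprime-2 {t} odd-t)))
  cop-8 : Coprime t 8
  cop-8 = Coprime.sym (coprime-^ 3 (Coprime.sym (odd⇒coprime-2 {t} odd-t)))
  cop-t² : Coprime t k → Coprime (t ²) (k * (p ² * r ⁴))
  cop-t² tk = Coprime.sym (coprime-² (Coprime.sym
    (coprime-* tk (coprime-* (coprime-² (Coprime.sym (∤⇒coprime pr p∤t))) (coprime-⁴ cop)))))

  no-a₂ : p % 8 ≡ 3 → ∀ a b → p ² * a ⁴ ≢ t ² + m * b ⁴
  no-a₂ p≡3 a b eq = no-√-1 pr p≡3 (root m≡) t p∤t
    (subst (p ∣_) (trans eq (trans (cong (t ² +_) (root² m≡)) (+-comm (t ²) _))) (∣m⇒∣m*n (a ⁴) (m∣m*n p)))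
    where
    root : m ≡ 4 ⊎ m ≡ 16 → ℕ
    root (inj₁ _) = 2 * b ²
    root (inj₂ _) = 4 * b ²
    ident : ∀ b → 4 * (b * b * (b * b)) ≡ 2 * (b * b) * (2 * (b * b))
    ident = solve-∀
    ident′ : ∀ b → 16 * (b * b * (b * b)) ≡ 4 * (b * b) * (4 * (b * b))
    ident′ = solve-∀
    root² : (h : m ≡ 4 ⊎ m ≡ 16) → m * b ⁴ ≡ root h ²
    root² (inj₁ refl) = ident b
    root² (inj₂ refl) = ident′ b

  no-c₂ : p % 8 ≡ 5 → ∀ c d → p ² * c ⁴ ≢ t ² + 8 * d ⁴
  no-c₂ p≡5 c d eq = no-√-2 pr p≡5 t (2 * d ²) p∤2d² p∣
    where
    ident : ∀ d → 8 * (d * d * (d * d)) ≡ 2 * (2 * (d * d) * (2 * (d * d)))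
    ident = solve-∀
    p∣ : p ∣ t ² + 2 * (2 * d ²) ²
    p∣ = subst (p ∣_) (trans eq (cong (t ² +_) (ident d))) (∣m⇒∣m*n (c ⁴) (m∣m*n p))
    p∤2d² : p ∤ 2 * d ²
    p∤2d² h = p∤t (prime∣²⇒∣ {n = t} pr (∣m+n∣m⇒∣n (subst (p ∣_) (+-comm (t ²) _) p∣) (∣n⇒∣m*n 2 (∣m⇒∣m*n (2 * d ²) h))))

  A : Set
  A = ∃₂ λ a b → r ≡ a * b × (a ⁴ ≡ t ² + m * (p ² * b ⁴) ⊎ p ² * a ⁴ ≡ t ² + m * b ⁴)
  C : Set
  C = ∃₂ λ c d → r ≡ c * d × (c ⁴ ≡ t ² + 8 * (p ² * d ⁴) ⊎ p ² * c ⁴ ≡ t ² + 8 * d ⁴)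

  impossible : r ≢ 0 → p % 8 ≡ 3 ⊎ p % 8 ≡ 5 → A → C → ⊥
  impossible r≢0 _ (a , b , r≡ , inj₁ e) (c , d , r≡′ , inj₁ e′) =
    incompatible₁₁ pr m≡ odd-t p∤t cop r≢0 a b c d r≡ r≡′ e e′
  impossible r≢0 (inj₁ p≡3) (a , b , r≡ , inj₁ e) (c , d , r≡′ , inj₂ e′) =
    incompatible₁₂ pr m≡ odd-t p∤t cop r≢0 a b c d r≡ r≡′ e e′
  impossible r≢0 (inj₁ p≡3) (a , b , r≡ , inj₂ e) _ = no-a₂ p≡3 a b e
  impossible r≢0 (inj₂ p≡5) (a , b , r≡ , inj₂ e) (c , d , r≡′ , inj₁ e′) =
    incompatible₂₁ pr m≡ odd-t p∤t cop r≢0 a b c d r≡ r≡′ e e′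
  impossible r≢0 (inj₂ p≡5) _ (c , d , r≡′ , inj₂ e′) = no-c₂ p≡5 c d e′

  conclude : Dec (r ≡ 0) → r ≡ 0
  conclude (yes h) = h
  conclude (no r≢0) = ⊥-elim (impossible r≢0 p%8
    (difference-split {t = t} {z = r} {v = u} {{m≢0 m≡}} (primary-m m≡) primary-p² (inj₁ (m%4 m≡ , p²%4)) odd-t (cop-t² (cop-m m≡)) equ)
    (difference-split {m = 8} {t = t} {z = r} {v = v} (primary-^ prime[2] 3) primary-p² (inj₁ (refl , p²%4)) odd-t (cop-t² cop-8) eqv))

-- Factorisation of the right-hand side

near-coprime-split : (∀ {d} → d ∣ m → d ∣ k → d ∣ 2) → m * k ≡ w ² →
  (Coprime m k × ∃₂ λ t v → m ≡ t ² × k ≡ v ²) ⊎ (∃₂ λ t v → m ≡ 2 * t ² × k ≡ 2 * v ²)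
near-coprime-split {m} {k} {w} common eq = go (2 ∣? m) (2 ∣? k)
  where
  Goal : Set
  Goal = (Coprime m k × ∃₂ λ t v → m ≡ t ² × k ≡ v ²) ⊎ (∃₂ λ t v → m ≡ 2 * t ² × k ≡ 2 * v ²)
  coprime-case : ¬ (2 ∣ m × 2 ∣ k) → Goal
  coprime-case not-both = inj₁ (cop , from (square-split {z = w} cop eq))
    where
    cop : Coprime m k
    cop (d∣m , d∣k) with prime⇒irreducible prime[2] (common d∣m d∣k)
    ... | inj₁ d≡1  = d≡1
    ... | inj₂ refl = contradiction (d∣m , d∣k) not-both
    from : (∃₂ λ a b → m ≡ a ² × k ≡ b ² × w ≡ a * b) → ∃₂ λ t v → m ≡ t ² × k ≡ v ²
    from (t , v , m≡ , k≡ , _) = t , v , m≡ , k≡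
  go : Dec (2 ∣ m) → Dec (2 ∣ k) → Goal
  go (no 2∤m) _ = coprime-case λ h → 2∤m (proj₁ h)
  go (yes _) (no 2∤k) = coprime-case λ h → 2∤k (proj₂ h)
  go (yes (divides i m≡)) (yes (divides j k≡)) = inj₂ (from (square-cancel {x = 2} {w = i * j} {z = w} eq′))
    where
    ident : ∀ i j → 2 * 2 * (i * j) ≡ i * 2 * (j * 2)
    ident = solve-∀
    eq′ : 2 ² * (i * j) ≡ w ²
    eq′ = trans (ident i j) (trans (cong₂ _*_ (sym m≡) (sym k≡)) eq)
    cop : Coprime i j
    cop {d} (d∣i , d∣j) = ∣1⇒≡1 (*-cancelʳ-∣ 2 (common
      (subst (d * 2 ∣_) (sym m≡) (*-monoˡ-∣ 2 d∣i)) (subst (d * 2 ∣_) (sym k≡) (*-monoˡ-∣ 2 d∣j))))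
    from : (∃ λ w′ → w ≡ 2 * w′ × i * j ≡ w′ ²) → ∃₂ λ t v → m ≡ 2 * t ² × k ≡ 2 * v ²
    from (w′ , _ , ij≡) with square-split {z = w′} cop ij≡
    ... | t , v , refl , refl , _ = t , v , trans m≡ (*-comm (t ²) 2) , trans k≡ (*-comm (v ²) 2)

split-off : ∀ m f g → Coprime f (m * g) → m * (f * g) ≡ w ² → ∃₂ λ u w′ → f ≡ u ² × m * g ≡ w′ ²
split-off {w} m f g cop eq with square-split {z = w} cop (trans (ident f m g) eq)
  where
  ident : ∀ f m g → f * (m * g) ≡ m * (f * g)
  ident = solve-∀
... | u , w′ , f≡ , mg≡ , _ = u , w′ , f≡ , mg≡

-- With p prime to m one takes α = 1 and puts a s⁴ into η. Once p has been divided out of m, the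
-- surplus p² or p³ appears as α and η is free of p.
module _ (α η : ℕ) (cop : Coprime (α * m) η) where

  private
    cop-m : Coprime m η
    cop-m = coprime-∣ (n∣m*n α) ∣-refl cop

    cop-αm² : Coprime (α * m ²) η
    cop-αm² = coprime-*ˡ {a = α} (coprime-∣ (m∣m*n m) ∣-refl cop) (coprime-*ˡ cop-m cop-m)

    ∣αm² : d ∣ m → d ∣ α * m ²
    ∣αm² d∣m = ∣n⇒∣m*n α (∣m⇒∣m*n m d∣m)

  first-factor-coprime : Coprime (α * m ² + η) (m * (α * m ² + 2 * η))
  first-factor-coprime = coprime-* with-m with-second
    where
    with-m : Coprime (α * m ² + η) m
    with-m (d∣f , d∣m) = cop-m (d∣m , ∣m+n∣m⇒∣n d∣f (∣αm² d∣m))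
    ident : ∀ x y → x + 2 * y ≡ x + y + y
    ident = solve-∀
    with-second : Coprime (α * m ² + η) (α * m ² + 2 * η)
    with-second {d} (d∣f , d∣g) = cop-αm² (∣m+n∣m⇒∣n (subst (d ∣_) (+-comm (α * m ²) η) d∣f) d∣η , d∣η)
      where
      d∣η : d ∣ η
      d∣η = ∣m+n∣m⇒∣n (subst (d ∣_) (ident (α * m ²) η) d∣g) d∣f

  common-divisor : d ∣ m → d ∣ α * m ² + 2 * η → d ∣ 2
  common-divisor {d} d∣m d∣g = coprime-divisor (coprime-∣ d∣m ∣-refl cop-m)
    (subst (d ∣_) (*-comm 2 η) (∣m+n∣m⇒∣n d∣g (∣αm² d∣m)))

  last-factor : m * (α * m ² + 2 * η) ≡ w ² →
    (Odd m × ∃₂ λ t v → m ≡ t ² × α * t ⁴ + 2 * η ≡ v ²) ⊎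
    (∃₂ λ t v → m ≡ 2 * t ² × 2 * (α * t ⁴) + η ≡ v ²)
  last-factor {w} eq = go (near-coprime-split {w = w} common-divisor eq)
    where
    ident : ∀ α t η → 2 * (2 * (α * (t * t * (t * t))) + η) ≡ α * (2 * (t * t) * (2 * (t * t))) + 2 * η
    ident = solve-∀
    odd-m : Coprime m (α * m ² + 2 * η) → Odd m
    odd-m c with even-or-odd m
    ... | inj₂ odd = odd
    ... | inj₁ even with () ← c {2} (m%n≡0⇒n∣m m 2 even ,
            ∣m∣n⇒∣m+n (∣αm² (m%n≡0⇒n∣m m 2 even)) (m∣m*n η))
    go : (Coprime m (α * m ² + 2 * η) × ∃₂ λ t v → m ≡ t ² × α * m ² + 2 * η ≡ v ²) ⊎
         (∃₂ λ t v → m ≡ 2 * t ² × α * m ² + 2 * η ≡ 2 * v ²) → _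
    go (inj₁ (c , t , v , m≡ , g≡)) =
      inj₁ (odd-m c , t , v , m≡ , trans (cong (λ i → α * i ² + 2 * η) (sym m≡)) g≡)
    go (inj₂ (t , v , m≡ , g≡)) = inj₂ (t , v , m≡ , *-cancelˡ-≡ _ _ 2
      (trans (ident α t η) (trans (cong (λ i → α * i ² + 2 * η) (sym m≡)) g≡)))

  factor-split : m * ((α * m ² + η) * (α * m ² + 2 * η)) ≡ w ² →
    ∃ λ u → α * m ² + η ≡ u ² ×
    ((Odd m × ∃₂ λ t v → m ≡ t ² × α * t ⁴ + 2 * η ≡ v ²) ⊎
     (∃₂ λ t v → m ≡ 2 * t ² × 2 * (α * t ⁴) + η ≡ v ²))
  factor-split {w} eq with split-off {w = w} m (α * m ² + η) (α * m ² + 2 * η) first-factor-coprime eq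
  ... | u , w′ , f≡ , mg≡ = u , f≡ , last-factor {w = w′} mg≡

  -- With the 2 beside α m² the three factors are pairwise coprime, so the prime 2 needs no case of
  -- its own. This shape arises for a = 2 p when m is halved.
  factor-split′ : m * ((α * m ² + η) * (2 * (α * m ²) + η)) ≡ w ² →
    ∃₂ λ t v → m ≡ t ² × 2 * (α * t ⁴) + η ≡ v ²
  factor-split′ {w} eq = go (split-off {w = w} m h f h-coprime (trans (cong (m *_) (*-comm h f)) eq))
    where
    f = α * m ² + η
    h = 2 * (α * m ²) + η
    f-coprime-m : Coprime m f
    f-coprime-m (d∣m , d∣f) = cop-m (d∣m , ∣m+n∣m⇒∣n d∣f (∣αm² d∣m))
    ident : ∀ x y → 2 * x + y ≡ x + y + x
    ident = solve-∀
    h-coprime : Coprime h (m * f)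
    h-coprime = coprime-* with-m with-f
      where
      with-m : Coprime h m
      with-m (d∣h , d∣m) = cop-m (d∣m , ∣m+n∣m⇒∣n d∣h (∣n⇒∣m*n 2 (∣αm² d∣m)))
      with-f : Coprime h f
      with-f {d} (d∣h , d∣f) = cop-αm² (d∣αm² , ∣m+n∣m⇒∣n d∣f d∣αm²)
        where
        d∣αm² = ∣m+n∣m⇒∣n (subst (d ∣_) (ident (α * m ²) η) d∣h) d∣f
    go : (∃₂ λ u w′ → h ≡ u ² × m * f ≡ w′ ²) → ∃₂ λ t v → m ≡ t ² × 2 * (α * t ⁴) + η ≡ v ²
    go (u , w′ , h≡ , mf≡) with square-split {z = w′} f-coprime-m mf≡
    ... | t , _ , m≡ , _ , _ = t , u , m≡ , trans (cong (λ i → 2 * (α * i ²) + η) (sym m≡)) h≡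

prime-square : Prime p → p * x ≡ w ² → ∃ λ w′ → x ≡ p * w′ ²
prime-square {p} {x} {w} pr eq with prime∣²⇒∣ {n = w} pr (subst (p ∣_) eq (m∣m*n x))
... | divides w′ refl = w′ , *-cancelˡ-≡ _ _ p {{prime⇒nonZero pr}} (trans eq (ident w′ p))
  where
  ident : ∀ w p → w * p * (w * p) ≡ p * (p * (w * w))
  ident = solve-∀

prime-∤2 : Prime p → p % 8 ≡ 3 ⊎ p % 8 ≡ 5 → p ∤ 2
prime-∤2 {p} pr p%8 p∣2 with prime⇒irreducible prime[2] p∣2
... | inj₁ refl = contradiction p%8 λ { (inj₁ ()) ; (inj₂ ()) }
... | inj₂ refl = contradiction p%8 λ { (inj₁ ()) ; (inj₂ ()) }

prime-∤* : Prime p → p ∤ m → p ∤ n → p ∤ m * n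
prime-∤* {m = m} {n} pr p∤m p∤n h = [ p∤m , p∤n ]′ (euclidsLemma m n pr h)

prime-∤⁴ : Prime p → p ∤ s → p ∤ s ⁴
prime-∤⁴ {s = s} pr p∤s h = p∤s (prime∣⁴⇒∣ {n = s} pr h)

-- As p divides m, each quadratic factor contains p exactly once; the exponent of p in m is
-- therefore even, and m = p² n. The free coefficients e, f, b, g cover a = p and both parities of m
-- for a = 2 p.
divide-out : ∀ e f b g → Prime p → p ∤ b → p ∤ g → p ∤ s → p ∣ m →
  m * ((e * m ² + p * b * s ⁴) * (f * m ² + p * g * s ⁴)) ≡ w ² →
  ∃₂ λ n w′ → m ≡ p * (p * n) ×
    n * ((e * (p * (p * p) * n ²) + b * s ⁴) * (f * (p * (p * p) * n ²) + g * s ⁴)) ≡ w′ ²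
divide-out {p} {s} {m} {w} e f b g pr p∤b p∤g p∤s (divides m′ refl) eq =
  from-square (square-cancel {x = p} {z = w} (trans (ident₁ p m′ e f b g S) eq))
  where
  instance _ = prime⇒nonZero pr
  S = s ⁴
  F = λ m → e * (p * m ²) + b * S
  G = λ m → f * (p * m ²) + g * S
  ident₁ : ∀ p m e f b g S →
    p * p * (p * (m * ((e * (p * (m * m)) + b * S) * (f * (p * (m * m)) + g * S)))) ≡
    m * p * ((e * (m * p * (m * p)) + p * b * S) * (f * (m * p * (m * p)) + p * g * S))
  ident₁ = solve-∀
  ident₂ : ∀ p n e f b g S →
    p * (n * ((e * (p * (p * p) * (n * n)) + b * S) * (f * (p * (p * p) * (n * n)) + g * S))) ≡
    n * p * ((e * (p * (n * p * (n * p))) + b * S) * (f * (p * (n * p * (n * p))) + g * S))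
  ident₂ = solve-∀
  p∤ : ∀ e b → p ∤ b → p ∤ e * (p * m′ ²) + b * S
  p∤ e b p∤b h = prime-∤* pr p∤b (prime-∤⁴ {s = s} pr p∤s) (∣m+n∣m⇒∣n h (∣n⇒∣m*n e (m∣m*n (m′ ²))))
  Goal : Set
  Goal = ∃₂ λ n w′ → m′ * p ≡ p * (p * n) ×
    n * ((e * (p * (p * p) * n ²) + b * s ⁴) * (f * (p * (p * p) * n ²) + g * s ⁴)) ≡ w′ ²
  conclude : ∀ w₂ → m′ * (F m′ * G m′) ≡ p * w₂ ² → p ∣ m′ → Goal
  conclude w₂ eq₂ (divides n refl) = n , w₂ , ident₃ n p ,
    *-cancelˡ-≡ _ _ p (trans (ident₂ p n e f b g S) eq₂)
    where
    ident₃ : ∀ n p → n * p * p ≡ p * (p * n)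
    ident₃ = solve-∀
  from-prime : (∃ λ w₂ → m′ * (F m′ * G m′) ≡ p * w₂ ²) → Goal
  from-prime (w₂ , eq₂) = conclude w₂ eq₂
    ([ (λ h → h) , (λ h → ⊥-elim (prime-∤* pr (p∤ e b p∤b) (p∤ f g p∤g) h)) ]′
      (euclidsLemma m′ (F m′ * G m′) pr (subst (p ∣_) (sym eq₂) (m∣m*n (w₂ ²)))))
  from-square : (∃ λ w₁ → w ≡ p * w₁ × p * (m′ * (F m′ * G m′)) ≡ w₁ ²) → Goal
  from-square (w₁ , _ , eq₁) = from-prime (prime-square {w = w₁} pr eq₁)

-- Points on the curves

-- The equation at the point (m / s², w / s⁵), multiplied by s¹⁰.
Curve : (a m s w : ℕ) → Set
Curve a m s w = m * ((m ² + a * s ⁴) * (m ² + 2 * (a * s ⁴))) ≡ w ²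

-- The alternative m = 2 t² gives v² = 2 t⁴ + a s⁴ and would make 2 a square modulo p, because p
-- divides a.
coprime-case : Prime p → p % 8 ≡ 3 ⊎ p % 8 ≡ 5 → p ∣ a → p ∤ m → Coprime m (a * s) → Curve a m s w →
  Odd m × ∃ λ t → ∃₂ λ u v → m ≡ t ² × t ⁴ + a * s ⁴ ≡ u ² × t ⁴ + 2 * (a * s ⁴) ≡ v ²
coprime-case {p} {a} {m} {s} {w} pr p%8 (divides a′ refl) p∤m cop eq =
  go (factor-split 1 (a * s ⁴) cop′ {w = w} (trans (ident m (a * s ⁴)) eq))
  where
  ident : ∀ m y → m * ((1 * (m * m) + y) * (1 * (m * m) + 2 * y)) ≡ m * ((m * m + y) * (m * m + 2 * y))
  ident = solve-∀
  cop′ : Coprime (1 * m) (a * s ⁴)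
  cop′ = subst (λ i → Coprime i (a * s ⁴)) (sym (*-identityˡ m))
    (coprime-* {b = a} (coprime-∣ ∣-refl (m∣m*n s) cop) (coprime-⁴ (coprime-∣ ∣-refl (n∣m*n a) cop)))
  go : (∃ λ u → 1 * m ² + a * s ⁴ ≡ u ² ×
        ((Odd m × ∃₂ λ t v → m ≡ t ² × 1 * t ⁴ + 2 * (a * s ⁴) ≡ v ²) ⊎
         (∃₂ λ t v → m ≡ 2 * t ² × 2 * (1 * t ⁴) + a * s ⁴ ≡ v ²))) →
       Odd m × ∃ λ t → ∃₂ λ u v → m ≡ t ² × t ⁴ + a * s ⁴ ≡ u ² × t ⁴ + 2 * (a * s ⁴) ≡ v ²
  go (u , f≡ , inj₁ (odd-m , t , v , m≡ , g≡)) = odd-m , t , u , v , m≡ ,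
    trans (cong (_+ a * s ⁴) (trans (cong _² (sym m≡)) (sym (*-identityˡ (m ²))))) f≡ ,
    trans (cong (_+ 2 * (a * s ⁴)) (sym (*-identityˡ (t ⁴)))) g≡
  go (u , f≡ , inj₂ (t , v , m≡ , g≡)) = ⊥-elim (no-√2 pr p%8 v (t ²) (a′ * s ⁴) p∤t²
    (trans (sym g≡) (ident′ t a′ p (s ⁴))))
    where
    p∤t² : p ∤ t ²
    p∤t² h = p∤m (subst (p ∣_) (sym m≡) (∣n⇒∣m*n 2 h))
    ident′ : ∀ t a p S → 2 * (1 * (t * t * (t * t))) + a * p * S ≡ 2 * (t * t * (t * t)) + a * S * p
    ident′ = solve-∀

-- The curves with a = p and a = 2 p

module _ (pr : Prime p) (p≡3 : p % 8 ≡ 3) where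

  private
    instance _ = prime⇒nonZero pr
    p³ = p * (p * p)
    instance _ = m*n≢0 p (p * p) {{prime⇒nonZero pr}} {{m*n≢0 p p}}
    p∤2 = prime-∤2 pr (inj₁ p≡3)

    p-admissible : Admissible 2 p
    p-admissible = twice (subst Primary (*-identityʳ p) (primary-^ pr 1)) p≡3

    p³-admissible : Admissible 2 p³
    p³-admissible = twice (subst Primary (cong (λ i → p * (p * i)) (*-identityʳ p)) (primary-^ pr 3))
      (mod-* 8 p (p * p) p≡3 (mod-* 8 p p p≡3 p≡3))

    p³-coprime : p ∤ s → Coprime p³ s
    p³-coprime p∤s = coprime-*ˡ ps (coprime-*ˡ ps ps)
      where ps = ∤⇒coprime pr p∤s

    quartic-p : Odd t → p ∤ t → Coprime t s → s ≢ 0 → t ⁴ + 2 * (p * s ⁴) ≢ v ²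
    quartic-p {t} {s} {v} odd-t p∤t ts s≢0 eq = s≢0 (descent p-admissible s {v = v} odd-t
      (coprime-* (odd⇒coprime-2 {t} odd-t) (coprime-* (Coprime.sym (∤⇒coprime pr p∤t)) ts)) eq)

    quartic-p³ : Odd s → p ∤ s → Coprime s t → t ≢ 0 → s ⁴ + 2 * (p³ * t ⁴) ≢ v ²
    quartic-p³ {s} {t} {v} odd-s p∤s st t≢0 eq = t≢0 (descent p³-admissible t {v = v} odd-s
      (coprime-* (odd⇒coprime-2 {s} odd-s) (coprime-* (Coprime.sym (p³-coprime p∤s)) st)) eq)

  -- If p does not divide m, the last factor is the quartic with Q = 2 p. Otherwise m = p² n: n = t²
  -- makes 2 a square modulo p, and n = 2 t² leaves s⁴ + 2 p³ t⁴ = v².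
  no-point-p : m ≢ 0 → s ≢ 0 → Coprime m s → ¬ Curve p m s w
  no-point-p {m} {s} {w} m≢0 s≢0 ms eq = by-divisibility (p ∣? m)
    where
    by-divisibility : Dec (p ∣ m) → ⊥
    by-divisibility (no p∤m) = go (coprime-case {w = w} pr (inj₁ p≡3) ∣-refl p∤m
        (coprime-* (Coprime.sym (∤⇒coprime pr p∤m)) ms) eq)
      where
      go : (Odd m × ∃ λ t → ∃₂ λ u v → m ≡ t ² × t ⁴ + p * s ⁴ ≡ u ² × t ⁴ + 2 * (p * s ⁴) ≡ v ²) → ⊥
      go (odd-m , t , u , v , refl , _ , eq′) = quartic-p {t} {s} {v} (odd-*ˡ t odd-m)
        (λ h → p∤m (∣m⇒∣m*n t h)) (coprime-∣ (m∣m*n t) ∣-refl ms) s≢0 eq′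
    by-divisibility (yes p∣m) = go (divide-out {s = s} {w = w} 1 1 1 2 pr p∤1 p∤2 p∤s p∣m (trans (ident m p (s ⁴)) eq))
      where
      p∤1 : p ∤ 1
      p∤1 h = nonTrivial⇒≢1 {{prime⇒nonTrivial pr}} (∣1⇒≡1 h)
      p∤s : p ∤ s
      p∤s = coprime⇒∤ pr p∣m ms
      ident : ∀ m p S → m * ((1 * (m * m) + p * 1 * S) * (1 * (m * m) + p * 2 * S)) ≡
                        m * ((m * m + p * S) * (m * m + 2 * (p * S)))
      ident = solve-∀
      ident′ : ∀ n q S → n * ((q * (n * n) + S) * (q * (n * n) + 2 * S)) ≡
                         n * ((1 * (q * (n * n)) + 1 * S) * (1 * (q * (n * n)) + 2 * S))
      ident′ = solve-∀
      finish : ∀ n → m ≡ p * (p * n) →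
        ((Odd n × ∃₂ λ t v → n ≡ t ² × p³ * t ⁴ + 2 * s ⁴ ≡ v ²) ⊎
         (∃₂ λ t v → n ≡ 2 * t ² × 2 * (p³ * t ⁴) + s ⁴ ≡ v ²)) → ⊥
      finish n m≡ (inj₁ (_ , t , v , _ , g≡)) = no-√2 pr (inj₁ p≡3) v (s ²) (p * p * t ⁴)
        (λ h → p∤s (prime∣²⇒∣ {n = s} pr h)) (trans (sym g≡) (rearrange p (t ⁴) (s ⁴)))
        where
        rearrange : ∀ p T S → p * (p * p) * T + 2 * S ≡ 2 * S + p * p * T * p
        rearrange = solve-∀
      finish n m≡ (inj₂ (t , v , refl , g≡)) = quartic-p³ {s} {t} {v}
        (even∧coprime⇒odd {2 * t ²} (even-* 2 (t ²) refl) ns) p∤s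
        (Coprime.sym (coprime-∣ (∣n⇒∣m*n 2 (m∣m*n t)) ∣-refl ns))
        (λ { refl → m≢0 (trans m≡ (vanish p)) })
        (trans (+-comm (s ⁴) _) g≡)
        where
        ns : Coprime (2 * t ²) s
        ns = coprime-∣ (subst (2 * t ² ∣_) (sym m≡) (∣n⇒∣m*n p (n∣m*n p))) ∣-refl ms
        vanish : ∀ p → p * (p * (2 * (0 * 0))) ≡ 0
        vanish = solve-∀
      go : (∃₂ λ n w′ → m ≡ p * (p * n) ×
             n * ((1 * (p³ * n ²) + 1 * s ⁴) * (1 * (p³ * n ²) + 2 * s ⁴)) ≡ w′ ²) → ⊥
      go (n , w′ , m≡ , eq′) = finish n m≡ (proj₂ (proj₂
        (factor-split p³ (s ⁴) (coprime-⁴ (coprime-*ˡ (p³-coprime p∤s) ns)) {w = w′} (trans (ident′ n p³ (s ⁴)) eq′))))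
        where
        ns : Coprime n s
        ns = coprime-∣ (subst (n ∣_) (sym m≡) (∣n⇒∣m*n p (n∣m*n p))) ∣-refl ms

  -- For odd m it is the middle factor that decides: it is t⁴ + 2 p s⁴, or p³ n² + 2 s⁴ if p divides
  -- m, and the latter cannot be a square. For m = 2 i the last factor takes the shape 2 t⁴ + p s⁴
  -- or 2 p³ t⁴ + s⁴.
  no-point-2p : m ≢ 0 → s ≢ 0 → Coprime m s → ¬ Curve (2 * p) m s w
  no-point-2p {m} {s} {w} m≢0 s≢0 ms eq = by-cases (even-or-odd m) (p ∣? m)
    where
    p∤1 : p ∤ 1
    p∤1 h = nonTrivial⇒≢1 {{prime⇒nonTrivial pr}} (∣1⇒≡1 h)
    even-case : ∀ i → m ≡ 2 * i → ⊥
    -- The factors 2 i, 4 i² + 2 p s⁴ and 4 i² + 4 p s⁴ release 2, 2 and 4, together 4².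
    even-case i refl = from-square (square-cancel {x = 4} {z = w} (trans (ident i p (s ⁴)) eq))
      where
      ident : ∀ i p S → 4 * 4 * (i * ((1 * (i * i) + p * 1 * S) * (2 * (i * i) + p * 1 * S))) ≡
        2 * i * ((2 * i * (2 * i) + 2 * p * S) * (2 * i * (2 * i) + 2 * (2 * p * S)))
      ident = solve-∀
      odd-s : Odd s
      odd-s = even∧coprime⇒odd {2 * i} (even-* 2 i refl) ms
      is : Coprime i s
      is = coprime-∣ (n∣m*n 2) ∣-refl ms
      by-divisibility : ∀ w′ → i * ((1 * i ² + p * 1 * s ⁴) * (2 * i ² + p * 1 * s ⁴)) ≡ w′ ² → Dec (p ∣ i) → ⊥
      by-divisibility w′ eq′ (no p∤i) = go
          (factor-split′ 1 (p * s ⁴) cop {w = w′} (trans (ident′ i p (s ⁴)) eq′))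
        where
        ident′ : ∀ i p S → i * ((1 * (i * i) + p * S) * (2 * (1 * (i * i)) + p * S)) ≡
                           i * ((1 * (i * i) + p * 1 * S) * (2 * (i * i) + p * 1 * S))
        ident′ = solve-∀
        cop : Coprime (1 * i) (p * s ⁴)
        cop = subst (λ j → Coprime j (p * s ⁴)) (sym (*-identityˡ i))
          (coprime-* (Coprime.sym (∤⇒coprime pr p∤i)) (coprime-⁴ is))
        go : (∃₂ λ t v → i ≡ t ² × 2 * (1 * t ⁴) + p * s ⁴ ≡ v ²) → ⊥
        go (t , v , i≡ , h≡) = no-√2 pr (inj₁ p≡3) v (t ²) (s ⁴)
          (λ h → p∤i (subst (p ∣_) (sym i≡) h)) (trans (sym h≡) (rearrange (t ⁴) p (s ⁴)))
          where
          rearrange : ∀ T p S → 2 * (1 * T) + p * S ≡ 2 * T + S * p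
          rearrange = solve-∀
      by-divisibility w′ eq′ (yes p∣i) = from-divided (divide-out {s = s} {w = w′} 1 2 1 1 pr p∤1 p∤1 p∤s p∣i eq′)
        where
        p∤s : p ∤ s
        p∤s = coprime⇒∤ pr p∣i is
        ident′ : ∀ n q S → n * ((q * (n * n) + S) * (2 * (q * (n * n)) + S)) ≡
                           n * ((1 * (q * (n * n)) + 1 * S) * (2 * (q * (n * n)) + 1 * S))
        ident′ = solve-∀
        from-divided : (∃₂ λ n w″ → i ≡ p * (p * n) ×
          n * ((1 * (p³ * n ²) + 1 * s ⁴) * (2 * (p³ * n ²) + 1 * s ⁴)) ≡ w″ ²) → ⊥
        from-divided (n , w″ , i≡ , eq″) = go
            (factor-split′ p³ (s ⁴) (coprime-⁴ (coprime-*ˡ (p³-coprime p∤s) ns)) {w = w″} (trans (ident′ n p³ (s ⁴)) eq″))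
          where
          ns : Coprime n s
          ns = coprime-∣ (subst (n ∣_) (sym i≡) (∣n⇒∣m*n p (n∣m*n p))) ∣-refl is
          vanish : ∀ p → 2 * (p * (p * (0 * 0))) ≡ 0
          vanish = solve-∀
          go : (∃₂ λ t v → n ≡ t ² × 2 * (p³ * t ⁴) + s ⁴ ≡ v ²) → ⊥
          go (t , v , refl , h≡) = quartic-p³ {s} {t} {v} odd-s p∤s
            (Coprime.sym (coprime-∣ (m∣m*n t) ∣-refl ns))
            (λ { refl → m≢0 (trans (cong (2 *_) i≡) (vanish p)) }) (trans (+-comm (s ⁴) _) h≡)
      from-square : (∃ λ w′ → w ≡ 4 * w′ × i * ((1 * i ² + p * 1 * s ⁴) * (2 * i ² + p * 1 * s ⁴)) ≡ w′ ²) → ⊥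
      from-square (w′ , _ , eq′) = by-divisibility w′ eq′ (p ∣? i)
    from-half : (∃ λ i → m ≡ 2 * i) → ⊥
    from-half (i , m≡) = even-case i m≡
    by-cases : Even m ⊎ Odd m → Dec (p ∣ m) → ⊥
    by-cases (inj₁ even) _ = from-half (even-half {m} even)
    by-cases (inj₂ odd-m) (no p∤m) = go (coprime-case {a = 2 * p} {w = w} pr (inj₁ p≡3) (n∣m*n 2) p∤m
        m-coprime eq)
      where
      m-coprime : Coprime m (2 * p * s)
      m-coprime = coprime-* {b = 2 * p} (coprime-* {b = 2} (odd⇒coprime-2 {m} odd-m) (Coprime.sym (∤⇒coprime pr p∤m))) ms
      go : (Odd m × ∃ λ t → ∃₂ λ u v → m ≡ t ² × t ⁴ + 2 * p * s ⁴ ≡ u ² × t ⁴ + 2 * (2 * p * s ⁴) ≡ v ²) → ⊥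
      go (_ , t , u , v , refl , eq′ , _) = quartic-p {t} {s} {u} (odd-*ˡ t odd-m)
        (λ h → p∤m (∣m⇒∣m*n t h)) (coprime-∣ (m∣m*n t) ∣-refl ms) s≢0
        (trans (cong (t ⁴ +_) (sym (*-assoc 2 p (s ⁴)))) eq′)
    by-cases (inj₂ odd-m) (yes p∣m) = go (divide-out {s = s} {w = w} 1 1 2 4 pr p∤2 (prime-∤* {m = 2} {2} pr p∤2 p∤2) p∤s p∣m
        (trans (ident m p (s ⁴)) eq))
      where
      p∤s : p ∤ s
      p∤s = coprime⇒∤ pr p∣m ms
      ident : ∀ m p S → m * ((1 * (m * m) + p * 2 * S) * (1 * (m * m) + p * 4 * S)) ≡
                        m * ((m * m + 2 * p * S) * (m * m + 2 * (2 * p * S)))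
      ident = solve-∀
      ident′ : ∀ n q S → n * ((q * (n * n) + 2 * S) * (q * (n * n) + 2 * (2 * S))) ≡
                         n * ((1 * (q * (n * n)) + 2 * S) * (1 * (q * (n * n)) + 4 * S))
      ident′ = solve-∀
      rearrange : ∀ p N S → p * (p * p) * N + 2 * S ≡ 2 * S + p * p * N * p
      rearrange = solve-∀
      go : (∃₂ λ n w′ → m ≡ p * (p * n) ×
             n * ((1 * (p³ * n ²) + 2 * s ⁴) * (1 * (p³ * n ²) + 4 * s ⁴)) ≡ w′ ²) → ⊥
      go (n , w′ , m≡ , eq′) = finish
        (factor-split p³ (2 * s ⁴) cop {w = w′} (trans (ident′ n p³ (s ⁴)) eq′))
        where
        n∣m : n ∣ m
        n∣m = subst (n ∣_) (sym m≡) (∣n⇒∣m*n p (n∣m*n p))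
        odd-p³n : Odd (p³ * n)
        odd-p³n = mod-* 2 p³ n (mod-* 2 p (p * p) odd-p (mod-* 2 p p odd-p odd-p)) odd-n
          where
          odd-p = mod-8⇒odd p p≡3 refl
          odd-n = odd-*ʳ p (odd-*ʳ p (subst Odd m≡ odd-m))
        cop : Coprime (p³ * n) (2 * s ⁴)
        cop = coprime-* {b = 2} (odd⇒coprime-2 {p³ * n} odd-p³n)
          (coprime-⁴ (coprime-*ˡ (p³-coprime p∤s) (coprime-∣ n∣m ∣-refl ms)))
        finish : (∃ λ u → p³ * n ² + 2 * s ⁴ ≡ u ² × _) → ⊥
        finish (u , f≡ , _) = no-√2 pr (inj₁ p≡3) u (s ²) (p * p * n ²)
          (λ h → p∤s (prime∣²⇒∣ {n = s} pr h)) (trans (sym f≡) (rearrange p (n ²) (s ⁴)))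

-- The curves with a = p²

even-root-square : q % 8 ≡ 1 → Odd t → t ⁴ + 2 * (q * s ⁴) ≡ v ² → Even s
even-root-square {q} {t} {s} {v} q%8 odd-t eq with even-or-odd s
... | inj₁ even = even
... | inj₂ odd-s = ⊥-elim ([ not (λ ()) , [ not (λ ()) , not (λ ()) ]′ ]′ (²-mod-8 v))
  where
  not : 3 ≢ r → v ² % 8 ≢ r
  not 3≢r h = 3≢r (trans (sym (mod-+ 8 (t ⁴) (2 * (q * s ⁴)) (odd⁴ t odd-t)
    (mod-* 8 2 (q * s ⁴) refl (mod-* 8 q (s ⁴) q%8 (odd⁴ s odd-s))))) (trans (cong (_% 8) eq) h))

quartic-2 : Odd t → Coprime t s → t ⁴ + 2 * s ⁴ ≡ v ² → s ≡ 0
quartic-2 {t} {s} {v} odd-t ts eq = descent two s {v = v} odd-t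
  (coprime-* {b = 2} (odd⇒coprime-2 {t} odd-t) (subst (Coprime t) (sym (*-identityˡ s)) ts))
  (trans (cong (λ i → t ⁴ + 2 * i) (*-identityˡ (s ⁴))) eq)

quartic-4 : Odd t → Coprime t s → t ⁴ + 4 * s ⁴ ≡ v ² → s ≡ 0
quartic-4 {t} {s} {v} odd-t ts eq = descent four s {v = v} odd-t
  (coprime-* {b = 4} (coprime-² (odd⇒coprime-2 {t} odd-t)) (subst (Coprime t) (sym (*-identityˡ s)) ts))
  (trans (cong (λ i → t ⁴ + 4 * i) (*-identityˡ (s ⁴))) eq)

odd-quartic-1 : Odd t → Coprime t s → t ⁴ + s ⁴ ≡ v ² → s ≡ 0
odd-quartic-1 {t} {s} {v} odd-t ts eq = descent one s {v = v} odd-t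
  (subst (Coprime t) (sym (trans (*-identityˡ (1 * s)) (*-identityˡ s))) ts)
  (trans (cong (t ⁴ +_) (trans (*-identityˡ (1 * s ⁴)) (*-identityˡ (s ⁴)))) eq)

quartic-1 : Coprime t s → t ≢ 0 → s ≢ 0 → t ⁴ + s ⁴ ≢ v ²
quartic-1 {t} {s} {v} ts t≢0 s≢0 eq with even-or-odd t
... | inj₂ odd-t  = s≢0 (odd-quartic-1 {t} {s} {v} odd-t ts eq)
... | inj₁ even-t = t≢0 (odd-quartic-1 {s} {t} {v} (even∧coprime⇒odd {t} even-t ts) (Coprime.sym ts)
    (trans (+-comm (s ⁴) (t ⁴)) eq))

module _ (pr : Prime p) (p%8 : p % 8 ≡ 3 ⊎ p % 8 ≡ 5) where

  private
    instance
      _ = prime⇒nonZero pr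
      _ = m*n≢0 p p

    p²%8 : p ² % 8 ≡ 1
    p²%8 = odd² p (mod-8⇒odd-prime {p} p%8)

  -- The second equation forces s = 2 r, which produces the constants 4 h (4 or 16) and 8 of
  -- `simultaneous`. The value h = 1 belongs to p ∤ m, and h = 4 to m = 2 p² t².
  simultaneous′ : ∀ h → h ≡ 1 ⊎ h ≡ 4 → Odd t → p ∤ t → Coprime t s → ∀ u v →
    t ⁴ + h * (p ² * s ⁴) ≡ u ² → t ⁴ + 2 * (p ² * s ⁴) ≡ v ² → s ≡ 0
  simultaneous′ {t} {s} h h≡ odd-t p∤t ts u v equ eqv =
    go (even-half {s} (even-root-square {p ²} {t} {s} {v} p²%8 odd-t eqv))
    where
    ident : ∀ h q r → h * (q * (2 * r * (2 * r) * (2 * r * (2 * r)))) ≡ 4 * (h * 4 * (q * (r * r * (r * r))))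
    ident = solve-∀
    h*4≡ : h ≡ 1 ⊎ h ≡ 4 → h * 4 ≡ 4 ⊎ h * 4 ≡ 16
    h*4≡ (inj₁ refl) = inj₁ refl
    h*4≡ (inj₂ refl) = inj₂ refl
    go : (∃ λ r → s ≡ 2 * r) → s ≡ 0
    go (r , refl) = cong (2 *_) {x = r} {y = 0} (simultaneous {r = r} pr p%8 (h*4≡ h≡) odd-t p∤t (coprime-∣ ∣-refl (n∣m*n 2) ts) u v
      (trans (sym equ) (cong (t ⁴ +_) (ident h (p ²) r)))
      (trans (sym eqv) (cong (t ⁴ +_) (ident 2 (p ²) r))))

  -- With m = i p the product is p⁵ i F G, so p divides i, F or G. If it divides F, then -1 is a
  -- square modulo p and p ≡ 5; if it divides G, then -2 is one and p ≡ 3. In these two cases the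
  -- remaining factors are free of p and lead to Q = 1, 2 or 4.
  no-point-p² : m ≢ 0 → s ≢ 0 → Coprime m s → ¬ Curve (p ²) m s w
  no-point-p² {m} {s} {w} m≢0 s≢0 ms eq = by-divisibility (p ∣? m)
    where
    divided : ∀ i → m ≡ i * p → p ∤ s → ⊥
    divided i refl p∤s = from-square (square-cancel {x = p * p} {z = w} (trans (ident p i (s ⁴)) eq))
      where
      is : Coprime i s
      is = coprime-∣ (m∣m*n p) ∣-refl ms
      F = i ² + s ⁴
      G = i ² + 2 * s ⁴
      ident : ∀ p i S → p * p * (p * p) * (p * (i * ((i * i + S) * (i * i + 2 * S)))) ≡
        i * p * ((i * p * (i * p) + p * p * S) * (i * p * (i * p) + 2 * (p * p * S)))
      ident = solve-∀
      1*-coprime : Coprime (1 * i) (s ⁴)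
      1*-coprime = subst (λ j → Coprime j (s ⁴)) (sym (*-identityˡ i)) (coprime-⁴ is)
      F-coprime : Coprime F (i * G)
      F-coprime = subst (λ j → Coprime (j + s ⁴) (i * (j + 2 * s ⁴))) (*-identityˡ (i ²))
        (first-factor-coprime 1 (s ⁴) 1*-coprime)
      i≢0 : i ≢ 0
      i≢0 refl = m≢0 refl
      odd-s : ∀ t → i ≡ 2 * t ² → Odd s
      odd-s t refl = even∧coprime⇒odd {2 * t ²} (even-* 2 (t ²) refl) is
      t≢0 : ∀ j t → i ≡ j * t ² → t ≢ 0
      t≢0 j t i≡ refl = i≢0 (trans i≡ (*-zeroʳ j))

      p∣i-case : ∀ w′ → i * (F * G) ≡ p * w′ ² → p ∣ i → ⊥
      p∣i-case w′ eq′ (divides n i≡) = finish (factor-split (p ²) (s ⁴) cop {w = w′}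
          (*-cancelˡ-≡ _ _ p (trans (ident′ p n (s ⁴)) (trans (cong (λ i → i * ((i ² + s ⁴) * (i ² + 2 * s ⁴))) (sym i≡)) eq′))))
        where
        ident′ : ∀ p n S → p * (n * ((p * p * (n * n) + S) * (p * p * (n * n) + 2 * S))) ≡
          n * p * ((n * p * (n * p) + S) * (n * p * (n * p) + 2 * S))
        ident′ = solve-∀
        ns : Coprime n s
        ns = coprime-∣ (subst (n ∣_) (sym i≡) (m∣m*n p)) ∣-refl is
        cop : Coprime (p ² * n) (s ⁴)
        cop = coprime-⁴ (coprime-*ˡ (coprime-*ˡ (∤⇒coprime pr p∤s) (∤⇒coprime pr p∤s)) ns)
        finish : (∃ λ u → p ² * n ² + s ⁴ ≡ u ² ×
          ((Odd n × ∃₂ λ t v → n ≡ t ² × p ² * t ⁴ + 2 * s ⁴ ≡ v ²) ⊎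
           (∃₂ λ t v → n ≡ 2 * t ² × 2 * (p ² * t ⁴) + s ⁴ ≡ v ²))) → ⊥
        finish (_ , _ , inj₁ (_ , t , v , _ , g≡)) = no-√2 pr p%8 v (s ²) (p * t ⁴)
          (λ h → p∤s (prime∣²⇒∣ {n = s} pr h)) (trans (sym g≡) (rearrange p (t ⁴) (s ⁴)))
          where
          rearrange : ∀ p T S → p * p * T + 2 * S ≡ 2 * S + p * T * p
          rearrange = solve-∀
        -- s and t exchange roles: s⁴ + 4 p² t⁴ and s⁴ + 2 p² t⁴ are squares.
        finish (u , f≡ , inj₂ (t , v , refl , g≡)) = t≢0 (2 * p) t i≡′
          (simultaneous′ {s} {t} 4 (inj₂ refl) (even∧coprime⇒odd {2 * t ²} (even-* 2 (t ²) refl) ns)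
            p∤s (Coprime.sym (coprime-∣ (∣n⇒∣m*n 2 (m∣m*n t)) ∣-refl ns)) u v
            (trans (rearrange (s ⁴) p t) f≡) (trans (+-comm (s ⁴) _) g≡))
          where
          i≡′ : i ≡ 2 * p * t ²
          i≡′ = trans i≡ (swap p (t ²))
            where
            swap : ∀ p T → 2 * T * p ≡ 2 * p * T
            swap = solve-∀
          rearrange : ∀ S p t → S + 4 * (p * p * (t * t * (t * t))) ≡ p * p * (2 * (t * t) * (2 * (t * t))) + S
          rearrange = solve-∀

      p∣F-case : ∀ w′ → i * (F * G) ≡ p * w′ ² → p ∣ F → p % 8 ≡ 3 ⊎ p % 8 ≡ 5 → ⊥
      p∣F-case w′ eq′ p∣F (inj₁ p≡3) = no-√-1 pr p≡3 i (s ²) (λ h → p∤s (prime∣²⇒∣ {n = s} pr h)) p∣F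
      p∣F-case w′ eq′ (divides f F≡) (inj₂ _) = from-split
          (split-off {w = w′} i f G (coprime-∣ (subst (f ∣_) (sym F≡) (m∣m*n p)) ∣-refl F-coprime)
            (*-cancelˡ-≡ _ _ p (trans (ident′ p i f G) (trans (cong (λ j → i * (j * G)) (sym F≡)) eq′))))
        where
        ident′ : ∀ p i f g → p * (i * (f * g)) ≡ i * (f * p * g)
        ident′ = solve-∀
        finish : (Odd i × ∃₂ λ t v → i ≡ t ² × 1 * t ⁴ + 2 * s ⁴ ≡ v ²) ⊎
                 (∃₂ λ t v → i ≡ 2 * t ² × 2 * (1 * t ⁴) + s ⁴ ≡ v ²) → ⊥
        finish (inj₁ (odd-i , t , v , refl , g≡)) = s≢0 (quartic-2 {t} {s} {v} (odd-*ˡ t odd-i)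
          (coprime-∣ (m∣m*n t) ∣-refl is) (trans (cong (_+ 2 * s ⁴) (sym (*-identityˡ (t ⁴)))) g≡))
        finish (inj₂ (t , v , i≡ , g≡)) = t≢0 2 t i≡ (quartic-2 {s} {t} {v} (odd-s t i≡)
          (Coprime.sym (coprime-∣ (subst (t ∣_) (sym i≡) (∣n⇒∣m*n 2 (m∣m*n t))) ∣-refl is))
          (trans (trans (+-comm (s ⁴) _) (cong (λ j → 2 * j + s ⁴) (sym (*-identityˡ (t ⁴))))) g≡))
        from-split : (∃₂ λ u w″ → f ≡ u ² × i * G ≡ w″ ²) → ⊥
        from-split (_ , w″ , _ , iG≡) = finish (last-factor 1 (s ⁴) 1*-coprime {w = w″}
          (trans (cong (λ j → i * (j + 2 * s ⁴)) (*-identityˡ (i ²))) iG≡))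

      p∣G-case : ∀ w′ → i * (F * G) ≡ p * w′ ² → p ∣ G → p % 8 ≡ 3 ⊎ p % 8 ≡ 5 → ⊥
      p∣G-case w′ eq′ p∣G (inj₂ p≡5) = no-√-2 pr p≡5 i (s ²) (λ h → p∤s (prime∣²⇒∣ {n = s} pr h)) p∣G
      p∣G-case w′ eq′ (divides g G≡) (inj₁ _) = from-split
          (split-off {w = w′} i F g (coprime-∣ ∣-refl (*-monoʳ-∣ i g∣G) F-coprime)
            (*-cancelˡ-≡ _ _ p (trans (ident′ p i F g) (trans (cong (λ j → i * (F * j)) (sym G≡)) eq′))))
        where
        g∣G : g ∣ G
        g∣G = subst (g ∣_) (sym G≡) (m∣m*n p)
        ident′ : ∀ p i f g → p * (i * (f * g)) ≡ i * (f * (g * p))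
        ident′ = solve-∀
        finish : ∀ u → F ≡ u ² → (Coprime i g × ∃₂ λ t v → i ≡ t ² × g ≡ v ²) ⊎
                 (∃₂ λ t v → i ≡ 2 * t ² × g ≡ 2 * v ²) → ⊥
        finish u F≡ (inj₁ (_ , t , _ , i≡ , _)) = quartic-1 {t} {s} {u}
          (coprime-∣ (subst (t ∣_) (sym i≡) (m∣m*n t)) ∣-refl is)
          (t≢0 1 t (trans i≡ (sym (*-identityˡ (t ²))))) s≢0
          (trans (cong (λ j → j ² + s ⁴) (sym i≡)) F≡)
        finish u F≡ (inj₂ (t , _ , i≡ , _)) = t≢0 2 t i≡ (quartic-4 {s} {t} {u} (odd-s t i≡)
          (Coprime.sym (coprime-∣ (subst (t ∣_) (sym i≡) (∣n⇒∣m*n 2 (m∣m*n t))) ∣-refl is))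
          (trans (rearrange (s ⁴) t) (trans (cong (λ j → j ² + s ⁴) (sym i≡)) F≡)))
          where
          rearrange : ∀ S t → S + 4 * (t * t * (t * t)) ≡ 2 * (t * t) * (2 * (t * t)) + S
          rearrange = solve-∀
        common : d ∣ i → d ∣ g → d ∣ 2
        common {d} d∣i d∣g = common-divisor 1 (s ⁴) 1*-coprime d∣i
          (subst (λ j → d ∣ j + 2 * s ⁴) (sym (*-identityˡ (i ²))) (∣-trans d∣g g∣G))
        from-split : (∃₂ λ u w″ → F ≡ u ² × i * g ≡ w″ ²) → ⊥
        from-split (u , w″ , F≡ , ig≡) = finish u F≡ (near-coprime-split {w = w″} common ig≡)

      from-prime : (∃ λ w′ → i * (F * G) ≡ p * w′ ²) → ⊥
      from-prime (w′ , eq′) =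
        [ p∣i-case w′ eq′
        , (λ h → [ (λ p∣F → p∣F-case w′ eq′ p∣F p%8) , (λ p∣G → p∣G-case w′ eq′ p∣G p%8) ]′ (euclidsLemma F G pr h))
        ]′ (euclidsLemma i (F * G) pr (subst (p ∣_) (sym eq′) (m∣m*n (w′ ²))))
      from-square : (∃ λ w′ → w ≡ p * p * w′ × p * (i * (F * G)) ≡ w′ ²) → ⊥
      from-square (w′ , _ , eq′) = from-prime (prime-square {w = w′} pr eq′)

    by-divisibility : Dec (p ∣ m) → ⊥
    by-divisibility (no p∤m) = go (coprime-case {w = w} pr p%8 (m∣m*n p) p∤m
        (coprime-* {b = p ²} (coprime-² mp) ms) eq)
      where
      mp : Coprime m p
      mp = Coprime.sym (∤⇒coprime pr p∤m)
      go : (Odd m × ∃ λ t → ∃₂ λ u v → m ≡ t ² × t ⁴ + p ² * s ⁴ ≡ u ² × t ⁴ + 2 * (p ² * s ⁴) ≡ v ²) → ⊥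
      go (odd-m , t , u , v , refl , equ , eqv) = s≢0 (simultaneous′ {t} {s} 1 (inj₁ refl) (odd-*ˡ t odd-m)
        (λ h → p∤m (∣m⇒∣m*n t h)) (coprime-∣ (m∣m*n t) ∣-refl ms) u v
        (trans (cong (t ⁴ +_) (*-identityˡ (p ² * s ⁴))) equ) eqv)
    by-divisibility (yes p∣m@(divides i m≡)) = divided i m≡ (coprime⇒∤ pr p∣m ms)

mod-16⇒mod-8 : ∀ p → p % 16 ≡ r → p % 8 ≡ r % 8
mod-16⇒mod-8 p refl = sym (m∣n⇒o%n%m≡o%m 8 16 p (divides 2 refl))

no-curve-point : Prime p → Cond p i j → m ≢ 0 → s ≢ 0 → Coprime m s → ¬ Curve (2 ^ i * p ^ j) m s w
no-curve-point {p} {m = m} {s} {w} pr (inj₁ (p≡3 , refl , refl)) m≢0 s≢0 ms eq =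
  no-point-p pr (mod-16⇒mod-8 p p≡3) {w = w} m≢0 s≢0 ms
    (subst (λ a → Curve a m s w) (trans (*-identityˡ (p * 1)) (*-identityʳ p)) eq)
no-curve-point {p} {m = m} {s} {w} pr (inj₂ (inj₁ (p≡11 , refl , refl))) m≢0 s≢0 ms eq =
  no-point-2p pr (mod-16⇒mod-8 p p≡11) {w = w} m≢0 s≢0 ms
    (subst (λ a → Curve a m s w) (cong (2 *_) (*-identityʳ p)) eq)
no-curve-point {p} {m = m} {s} {w} pr (inj₂ (inj₂ (inj₁ (p≡3 , refl , refl)))) m≢0 s≢0 ms eq =
  no-point-p² pr (inj₁ p≡3) {w = w} m≢0 s≢0 ms
    (subst (λ a → Curve a m s w) (trans (*-identityˡ (p * (p * 1))) (cong (p *_) (*-identityʳ p))) eq)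
no-curve-point {p} {m = m} {s} {w} pr (inj₂ (inj₂ (inj₂ (p≡5 , refl , refl)))) m≢0 s≢0 ms eq =
  no-point-p² pr (inj₂ p≡5) {w = w} m≢0 s≢0 ms
    (subst (λ a → Curve a m s w) (trans (*-identityˡ (p * (p * 1))) (cong (p *_) (*-identityʳ p))) eq)

-- Modulo n both quadratic factors are m², so n is coprime to everything else in the product and
-- must itself be a square s².
no-coprime-point : Prime p → Cond p i j → m ≢ 0 → n ≢ 0 → Coprime m n →
  let a = 2 ^ i * p ^ j in n * (m * ((m ² + a * n ²) * (m ² + 2 * (a * n ²)))) ≢ z ²
no-coprime-point {p} {i} {j} {m} {n} {z} pr cond m≢0 n≢0 mn eq = go (square-split {z = z} cop eq)
  where
  A = 2 ^ i * p ^ j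
  cop-+ : ∀ e → Coprime n (m ² + e * n ²)
  cop-+ e {d} (d∣n , d∣f) = Coprime.sym (coprime-*ˡ mn mn)
    (d∣n , ∣m+n∣m⇒∣n (subst (d ∣_) (+-comm (m ²) _) d∣f) (∣n⇒∣m*n e (∣m⇒∣m*n n d∣n)))
  cop : Coprime n (m * ((m ² + A * n ²) * (m ² + 2 * (A * n ²))))
  cop = coprime-* (Coprime.sym mn) (coprime-* (cop-+ A)
    (subst (λ e → Coprime n (m ² + e)) (*-assoc 2 A (n ²)) (cop-+ (2 * A))))
  go : (∃₂ λ s w → n ≡ s ² × m * ((m ² + A * n ²) * (m ² + 2 * (A * n ²))) ≡ w ² × z ≡ s * w) → ⊥
  go (s , w , refl , eq′ , _) = no-curve-point {s = s} {w} pr cond m≢0 (λ { refl → n≢0 refl })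
    (coprime-∣ ∣-refl (m∣m*n s) mn) eq′

-- From rational points to natural numbers

i*i≡+∣i∣² : ∀ i → i ℤ.* i ≡ ℤ.+ (ℤ.∣ i ∣ ²)
i*i≡+∣i∣² (ℤ.+ n)      = sym (ℤ.pos-* n n)
i*i≡+∣i∣² (ℤ.-[1+ n ]) = refl

∣↥-*∣ : ∀ p q → ℤ.∣ ℚᵘ.↥ (p ℚᵘ.* q) ∣ ≡ ℤ.∣ ℚᵘ.↥ p ∣ * ℤ.∣ ℚᵘ.↥ q ∣
∣↥-*∣ p@record{} q@record{} = ℤ.abs-* (ℚᵘ.↥ p) (ℚᵘ.↥ q)

↧ₙ-* : ∀ p q → ℚᵘ.↧ₙ (p ℚᵘ.* q) ≡ ℚᵘ.↧ₙ p * ℚᵘ.↧ₙ q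
↧ₙ-* record{} record{} = refl

∣↥-²+∣ : ∀ p a → ℤ.∣ ℚᵘ.↥ (p ℚᵘ.* p ℚᵘ.+ mkℚᵘ (ℤ.+ a) 0) ∣ ≡ ℤ.∣ ℚᵘ.↥ p ∣ ² + a * ℚᵘ.↧ₙ p ²
∣↥-²+∣ p@record{} a = cong ℤ.∣_∣ (begin
  ℚᵘ.↥ p ℤ.* ℚᵘ.↥ p ℤ.* ℤ.+ 1 ℤ.+ ℤ.+ a ℤ.* ℤ.+ (ℚᵘ.↧ₙ p ²)
    ≡⟨ cong₂ ℤ._+_ (trans (ℤ.*-identityʳ _) (i*i≡+∣i∣² (ℚᵘ.↥ p))) (sym (ℤ.pos-* a (ℚᵘ.↧ₙ p ²))) ⟩
  ℤ.+ (ℤ.∣ ℚᵘ.↥ p ∣ ²) ℤ.+ ℤ.+ (a * ℚᵘ.↧ₙ p ²)  ≡⟨⟩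
  ℤ.+ (ℤ.∣ ℚᵘ.↥ p ∣ ² + a * ℚᵘ.↧ₙ p ²)          ∎)
  where open ≡-Reasoning

↧ₙ-²+ : ∀ p a → ℚᵘ.↧ₙ (p ℚᵘ.* p ℚᵘ.+ mkℚᵘ (ℤ.+ a) 0) ≡ ℚᵘ.↧ₙ p ²
↧ₙ-²+ p@record{} a = *-identityʳ (ℚᵘ.↧ₙ p ²)

-- Only absolute values of the two sides are compared. The quadratic factors are positive, so the
-- sign of x merely disappears, and negative x needs no separate argument.
clear-denominators : ∀ a b p q →
  q ℚᵘ.* q ℚᵘ.≃ p ℚᵘ.* ((p ℚᵘ.* p ℚᵘ.+ mkℚᵘ (ℤ.+ a) 0) ℚᵘ.* (p ℚᵘ.* p ℚᵘ.+ mkℚᵘ (ℤ.+ b) 0)) →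
  let m = ℤ.∣ ℚᵘ.↥ p ∣; n = ℚᵘ.↧ₙ p; k = ℤ.∣ ℚᵘ.↥ q ∣; l = ℚᵘ.↧ₙ q in
  k ² * (n * (n ² * n ²)) ≡ m * ((m ² + a * n ²) * (m ² + b * n ²)) * l ²
clear-denominators a b p q (*≡* eq) = begin
  K ² * (N * (N ² * N ²))                                   ≡⟨ cong₂ _*_ (sym (∣↥-*∣ q q)) (sym den-R) ⟩
  ℤ.∣ ℚᵘ.↥ (q ℚᵘ.* q) ∣ * ℚᵘ.↧ₙ R                           ≡⟨ sym (ℤ.abs-* (ℚᵘ.↥ (q ℚᵘ.* q)) (ℚᵘ.↧ R)) ⟩
  ℤ.∣ ℚᵘ.↥ (q ℚᵘ.* q) ℤ.* ℚᵘ.↧ R ∣                          ≡⟨ cong ℤ.∣_∣ eq ⟩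
  ℤ.∣ ℚᵘ.↥ R ℤ.* ℚᵘ.↧ (q ℚᵘ.* q) ∣                          ≡⟨ ℤ.abs-* (ℚᵘ.↥ R) (ℚᵘ.↧ (q ℚᵘ.* q)) ⟩
  ℤ.∣ ℚᵘ.↥ R ∣ * ℚᵘ.↧ₙ (q ℚᵘ.* q)                           ≡⟨ cong₂ _*_ num-R (↧ₙ-* q q) ⟩
  M * ((M ² + a * N ²) * (M ² + b * N ²)) * L ²             ∎
  where
  open ≡-Reasoning
  M = ℤ.∣ ℚᵘ.↥ p ∣
  N = ℚᵘ.↧ₙ p
  K = ℤ.∣ ℚᵘ.↥ q ∣
  L = ℚᵘ.↧ₙ q
  F = p ℚᵘ.* p ℚᵘ.+ mkℚᵘ (ℤ.+ a) 0
  G = p ℚᵘ.* p ℚᵘ.+ mkℚᵘ (ℤ.+ b) 0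
  R = p ℚᵘ.* (F ℚᵘ.* G)
  num-R : ℤ.∣ ℚᵘ.↥ R ∣ ≡ M * ((M ² + a * N ²) * (M ² + b * N ²))
  num-R = trans (∣↥-*∣ p (F ℚᵘ.* G)) (cong (M *_) (trans (∣↥-*∣ F G) (cong₂ _*_ (∣↥-²+∣ p a) (∣↥-²+∣ p b))))
  den-R : ℚᵘ.↧ₙ R ≡ N * (N ² * N ²)
  den-R = trans (↧ₙ-* p (F ℚᵘ.* G)) (cong (N *_) (trans (↧ₙ-* F G) (cong₂ _*_ (↧ₙ-²+ p a) (↧ₙ-²+ p b))))

-- In unnormalised fractions the numerator and denominator of sums and products are explicit
-- polynomials, whereas the operations of ℚ divide by gcds.
toℚᵘ-curve : ∀ p i j x y → OnCurve p i j x y →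
  let X = toℚᵘ x; Y = toℚᵘ y in
  Y ℚᵘ.* Y ℚᵘ.≃ X ℚᵘ.* ((X ℚᵘ.* X ℚᵘ.+ mkℚᵘ (ℤ.+ (2 ^ i * p ^ j)) 0) ℚᵘ.*
                         (X ℚᵘ.* X ℚᵘ.+ mkℚᵘ (ℤ.+ (2 ^ suc i * p ^ j)) 0))
toℚᵘ-curve p i j x y eq = begin
  toℚᵘ y ℚᵘ.* toℚᵘ y                              ≈⟨ ℚ.toℚᵘ-homo-* y y ⟨
  toℚᵘ (y ℚ.* y)                                  ≡⟨ cong toℚᵘ eq ⟩
  toℚᵘ (rhs p i j x)                              ≈⟨ ℚ.toℚᵘ-homo-* x (f ℚ.* g) ⟩
  toℚᵘ x ℚᵘ.* toℚᵘ (f ℚ.* g)                      ≈⟨ ℚᵘ.*-congˡ {toℚᵘ x} (ℚ.toℚᵘ-homo-* f g) ⟩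
  toℚᵘ x ℚᵘ.* (toℚᵘ f ℚᵘ.* toℚᵘ g)                ≈⟨ ℚᵘ.*-congˡ {toℚᵘ x} (ℚᵘ.*-cong (factor i) (factor (suc i))) ⟩
  toℚᵘ x ℚᵘ.* ((toℚᵘ x ℚᵘ.* toℚᵘ x ℚᵘ.+ mkℚᵘ (ℤ.+ (2 ^ i * p ^ j)) 0) ℚᵘ.*
               (toℚᵘ x ℚᵘ.* toℚᵘ x ℚᵘ.+ mkℚᵘ (ℤ.+ (2 ^ suc i * p ^ j)) 0)) ∎
  where
  open import Relation.Binary.Reasoning.Setoid ℚᵘ.≃-setoid
  f = x ℚ.* x ℚ.+ coeff p i j
  g = x ℚ.* x ℚ.+ coeff p (suc i) j
  factor : ∀ i → toℚᵘ (x ℚ.* x ℚ.+ coeff p i j) ℚᵘ.≃ toℚᵘ x ℚᵘ.* toℚᵘ x ℚᵘ.+ mkℚᵘ (ℤ.+ (2 ^ i * p ^ j)) 0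
  factor i = ℚᵘ.≃-trans (ℚ.toℚᵘ-homo-+ (x ℚ.* x) (coeff p i j))
    (ℚᵘ.+-cong (ℚ.toℚᵘ-homo-* x x) (ℚ.toℚᵘ-fromℚᵘ (mkℚᵘ (ℤ.+ (2 ^ i * p ^ j)) 0)))

numerators-vanish : Prime p → Cond p i j → ∀ m n k l .{{_ : NonZero n}} .{{_ : NonZero l}} → Coprime m n →
  k ² * (n * (n ² * n ²)) ≡ m * ((m ² + 2 ^ i * p ^ j * n ²) * (m ² + 2 ^ suc i * p ^ j * n ²)) * l ² →
  m ≡ 0 × k ≡ 0
numerators-vanish {p} {i} {j} pr cond m n k l mn eq = m≡0 , k≡0
  where
  A = 2 ^ i * p ^ j
  F = m ² + A * n ²
  G = m ² + 2 * (A * n ²)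
  eq′ : k ² * (n * (n ² * n ²)) ≡ m * (F * G) * l ²
  eq′ = trans eq (cong (λ h → m * (F * (m ² + h)) * l ²)
    (trans (cong (_* n ²) (*-assoc 2 (2 ^ i) (p ^ j))) (*-assoc 2 A (n ²))))
  -- One further factor n completes k² n⁵ to the square of k n³; cancelling l² then shows that n m F
  -- G is a square.
  squared : l ² * (n * (m * (F * G))) ≡ (k * (n * n ²)) ²
  squared = trans (ident₁ l n (m * (F * G))) (trans (cong (n *_) (sym eq′)) (ident₂ n k))
    where
    ident₁ : ∀ l n h → l * l * (n * h) ≡ n * (h * (l * l))
    ident₁ = solve-∀
    ident₂ : ∀ n k → n * (k * k * (n * (n * n * (n * n)))) ≡ k * (n * (n * n)) * (k * (n * (n * n)))
    ident₂ = solve-∀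
  m≡0 : m ≡ 0
  m≡0 with m ≟ 0 | square-cancel {x = l} {z = k * (n * n ²)} squared
  ... | yes m≡0 | _ = m≡0
  ... | no  m≢0 | z , _ , eq″ = ⊥-elim (no-coprime-point {z = z} pr cond m≢0 (≢-nonZero⁻¹ n) mn eq″)
  k≡0 : k ≡ 0
  k≡0 = [ (λ k²≡0 → reduce (m*n≡0⇒m≡0∨n≡0 k k²≡0))
        , (λ h → ⊥-elim (≢-nonZero⁻¹ _ {{m*n≢0 n (n ² * n ²) {{it}} {{m*n≢0 (n ²) (n ²) {{m*n≢0 n n}} {{m*n≢0 n n}}}}}} h)) ]′
        (m*n≡0⇒m≡0∨n≡0 (k ²) (trans eq′ (cong (λ h → h * (F * G) * l ²) m≡0)))

theorem1p1 : (p i j : ℕ) → Prime p → Cond p i j →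
    (x y : ℚ) → OnCurve p i j x y ⇔ (x ≡ 0ℚ × y ≡ 0ℚ)
theorem1p1 p i j pr cond x y = mk⇔ to from
  where
  to : OnCurve p i j x y → x ≡ 0ℚ × y ≡ 0ℚ
  to eq = vanish x (proj₁ numerators) , vanish y (proj₂ numerators)
    where
    numerator-vanishes : ∀ x y → OnCurve p i j x y → ℤ.∣ ↥ x ∣ ≡ 0 × ℤ.∣ ↥ y ∣ ≡ 0
    numerator-vanishes x@(mkℚ m d-1 cop) y@(mkℚ k e-1 _) eq =
      numerators-vanish pr cond ℤ.∣ m ∣ (suc d-1) ℤ.∣ k ∣ (suc e-1) (Coprime.recompute cop)
        (clear-denominators (2 ^ i * p ^ j) (2 ^ suc i * p ^ j) (toℚᵘ x) (toℚᵘ y) (toℚᵘ-curve p i j x y eq))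
    numerators = numerator-vanishes x y eq
    vanish : ∀ x → ℤ.∣ ↥ x ∣ ≡ 0 → x ≡ 0ℚ
    vanish x h = ℚ.↥p≡0⇒p≡0 x (ℤ.∣i∣≡0⇒i≡0 h)
  from : x ≡ 0ℚ × y ≡ 0ℚ → OnCurve p i j x y
  from (refl , refl) = sym (ℚ.*-zeroˡ ((0ℚ ℚ.* 0ℚ ℚ.+ coeff p i j) ℚ.* (0ℚ ℚ.* 0ℚ ℚ.+ coeff p (suc i) j)))
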